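{- Let $m \geq 3$ and $d\ge 1$ be integers and let $G_1=(C_m^d)_1$ be the graph defined in the context. Then there exists a vertex-spine of $G_1$ containing at most $2\pi\sqrt d\, m^{d-1}$ vertices.
   Context: $C_m$ denotes the cycle on the vertex set $M=\{1,2,\ldots,m\}$ (in this cyclic order). $G_1=(C_m^d)_1$ is the graph with vertex set $M^d$ in which two vertices $(i_1,\ldots,i_d)$ and $(j_1,\ldots,j_d)$ are adjacent iff they are equal in all coordinates but one, in which they are adjacent in $C_m$. A cycle in $G_1$ is called nontrivial if its projection along at least one of the coordinates contains the full cycle $C_m$. A vertex-spine is a set of vertices that intersects every nontrivial cycle. -}

module Defs where

open import Data.Nat as ℕ using (ℕ; zero; suc; _≤_; _<_; _^_; _∸_)
open import Data.Integer using (+_; -[1+_])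
open import Data.Rational as ℚ using (ℚ; 0ℚ; _/_)
open import Data.Fin using (Fin; toℕ)
open import Data.Vec using (Vec; lookup)
open import Data.List using (List; length)
open import Data.List.Membership.Propositional using (_∈_)
open import Data.List.Relation.Unary.Unique.Propositional using (Unique)
open import Data.Product using (Σ; ∃; ∃-syntax; _×_)
open import Data.Sum using (_⊎_)
open import Relation.Nullary using (¬_)
open import Relation.Binary.PropositionalEquality using (_≡_; _≢_)

-- Vertices of G₁ = (C_m^d)₁ : d-tuples over M = Fin m (label a ∈ Fin m stands for a+1).
Vertex : ℕ → ℕ → Set
Vertex m d = Vec (Fin m) d

CStep : (m : ℕ) → Fin m → Fin m → Set
CStep m a b = (suc (toℕ a) ≡ toℕ b) ⊎ ((suc (toℕ a) ≡ m) × (toℕ b ≡ 0))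

CAdj : (m : ℕ) → Fin m → Fin m → Set
CAdj m a b = CStep m a b ⊎ CStep m b a

Adj : (m d : ℕ) → Vertex m d → Vertex m d → Set
Adj m d u v = ∃[ i ] (CAdj m (lookup u i) (lookup v i)
                      × (∀ j → j ≢ i → lookup u j ≡ lookup v j))

record Cycle (m d : ℕ) : Set where
  field
    len      : ℕ
    len≥3    : 3 ≤ len
    vtx      : ℕ → Vertex m d
    periodic : ∀ k → vtx (k ℕ.+ len) ≡ vtx k
    adjacent : ∀ k → Adj m d (vtx k) (vtx (suc k))
    distinct : ∀ i j → i < len → j < len → vtx i ≡ vtx j → i ≡ j
open Cycle public

EdgeCovers : (m d : ℕ) → Cycle m d → Fin d → ℕ → Fin m → Set
EdgeCovers m d C c k a =
  ∃[ b ] (CStep m a b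
          × ((lookup (vtx C k) c ≡ a × lookup (vtx C (suc k)) c ≡ b)
             ⊎ (lookup (vtx C k) c ≡ b × lookup (vtx C (suc k)) c ≡ a)))

-- Nontrivial: the projection along some coordinate contains the full cycle C_m,
-- i.e. every edge of C_m is the projection of some edge of the cycle.
Nontrivial : (m d : ℕ) → Cycle m d → Set
Nontrivial m d C = ∃[ c ] (∀ (a : Fin m) → ∃[ k ] (k < len C × EdgeCovers m d C c k a))

IsVertexSpine : (m d : ℕ) → List (Vertex m d) → Set
IsVertexSpine m d S =
  Unique S × (∀ (C : Cycle m d) → Nontrivial m d C → ∃[ k ] (vtx C k ∈ S))

-- Leibniz partial sums: leibniz n = 4 Σ_{k<n} (-1)^k / (2k+1).
-- The odd-indexed ones leibniz (2n+1) are rational upper bounds decreasing to π.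
leibnizTerm : ℕ → ℚ
leibnizTerm k with k ℕ.% 2
... | zero  = + 4 / suc (2 ℕ.* k)
... | suc _ = -[1+ 3 ] / suc (2 ℕ.* k)

leibniz : ℕ → ℚ
leibniz zero    = 0ℚ
leibniz (suc n) = leibniz n ℚ.+ leibnizTerm n

ℕ→ℚ : ℕ → ℚ
ℕ→ℚ n = + n / 1

-- N ≤ 2π√d·m^(d-1)  ⇔  N² ≤ 4·d·m^(2(d-1))·π²  ⇔  ∀ n, N² ≤ 4·d·m^(2(d-1))·(leibniz(2n+1))²
BoundedBy2π√dm^[d-1] : (N m d : ℕ) → Set
BoundedBy2π√dm^[d-1] N m d =
  ∀ n → ℕ→ℚ (N ℕ.* N) ℚ.≤
        (ℕ→ℚ (4 ℕ.* d ℕ.* (m ^ (2 ℕ.* (d ∸ 1)))) ℚ.* (leibniz (suc (2 ℕ.* n)) ℚ.* leibniz (suc (2 ℕ.* n))))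

{-# OPTIONS --safe #-}
module Submission where

-- Only π ≥ 3 is needed, so it suffices to find S with m·|S| ≤ r·m^d and r² ≤ 36d.  All vertices (r = m) and the
-- vertices with a zero coordinate (r = d) settle m² ≤ 36d and d ≤ 36.  Otherwise let e = ⌊√d⌋ ≥ 6; the torus is
-- covered greedily by cells, and the boundaries of the cells form the spine with r = 6e.
--
-- With δ the cyclic distance truncated at N, the cell of centre t and level s consists of the x with all
-- δ(xᵢ,tᵢ) ≥ 1 and σ = Σᵢ δ(xᵢ,tᵢ) ≥ s; it misses the value tᵢ in every coordinate i, so it contains no nontrivial
-- cycle.  Its inner boundary lies in {σ = s} ∪ {some δ(xᵢ,tᵢ) = 1}.  As in Cheeger's inequality, levels are averaged
-- with weights whose partial sums are (a/b)^σ, a = b + 1.  For every fixed x the average over all t and s factorises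
-- over the coordinates: {σ = s} contributes 1/a of the cell, and each coordinate with δ = 1 contributes little since
-- (a/b)^N ≥ 2^e > d.  Hence some (t, s) has a boundary that is small relative to its cell even after both are
-- restricted to the set of vertices still uncovered, and removing that cell and recursing covers everything.

open import Defs
open import Data.Bool using (if_then_else_; true; false)
open import Data.Empty using (⊥-elim)
open import Data.Fin using (Fin; toℕ; zero; suc)
import Data.Fin as Fin
open import Data.Fin.Properties using (toℕ<n; all?)
import Data.Integer as ℤ
import Data.Integer.Properties as ℤₚ
open import Data.List using (List; []; _∷_; _++_; length; map; filter; allFin; upTo; applyUpTo; tabulate; cartesianProductWith)
open import Data.List.Membership.Propositional using (_∈_)
open import Data.List.Membership.Propositional.Properties using (∈-filter⁺; ∈-filter⁻; ∈-++⁺ˡ; ∈-++⁺ʳ; ∈-++⁻; ∈-cartesianProductWith⁺; ∈-allFin)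
open import Data.List.Properties using (length-++; map-cong; map-++; map-∘; map-upTo; map-tabulate)
open import Data.List.Relation.Unary.All using ([])
open import Data.List.Relation.Unary.AllPairs using ([]; _∷_)
open import Data.List.Relation.Unary.Any using (here)
open import Data.List.Relation.Unary.Unique.Propositional using (Unique)
open import Data.List.Relation.Unary.Unique.Propositional.Properties using (filter⁺; ++⁺; cartesianProductWith⁺; allFin⁺)
open import Data.Nat
open import Data.Nat.DivMod using (m≡m%n+[m/n]*n; m%n<n)
open import Data.Nat.ListAction using (sum)
open import Data.Nat.ListAction.Properties using (sum-++)
open import Data.Nat.Properties
open import Data.Nat.Solver using (module +-*-Solver)
open import Data.Product using (∃-syntax; _×_; _,_; proj₁; proj₂)
open import Data.Rational as ℚ using (ℚ; 0ℚ)
import Data.Rational.Properties as ℚₚ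
open import Data.Rational.Unnormalised as ℚᵘ using (mkℚᵘ; *≤*)
import Data.Rational.Unnormalised.Properties as ℚᵘₚ
open import Data.Sum using (_⊎_; inj₁; inj₂)
open import Data.Vec using ([]; _∷_; lookup; replicate)
open import Data.Vec.Properties using (∷-injective; lookup-replicate)
open import Function using (_∘_)
open import Relation.Binary.PropositionalEquality
open import Relation.Nullary using (Dec; does; yes; no; ¬_; contradiction; _×-dec_; _⊎-dec_)
open import Relation.Nullary.Decidable using (¬?; from-yes)
open import Relation.Unary using (Decidable)

-- Finite sums

ind : {P : Set} → Dec P → ℕ
ind p = if does p then 1 else 0

module _ {A : Set} where

  ∑ : List A → (A → ℕ) → ℕ
  ∑ xs f = sum (map f xs)

  ∑-cong : ∀ xs {f g : A → ℕ} → (∀ x → f x ≡ g x) → ∑ xs f ≡ ∑ xs g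
  ∑-cong xs f≗g = cong sum (map-cong f≗g xs)

  ∑-mono : ∀ xs {f g : A → ℕ} → (∀ x → f x ≤ g x) → ∑ xs f ≤ ∑ xs g
  ∑-mono []       f≤g = z≤n
  ∑-mono (x ∷ xs) f≤g = +-mono-≤ (f≤g x) (∑-mono xs f≤g)

  ∑-++ : ∀ xs ys (f : A → ℕ) → ∑ (xs ++ ys) f ≡ ∑ xs f + ∑ ys f
  ∑-++ xs ys f = trans (cong sum (map-++ f xs ys)) (sum-++ (map f xs) (map f ys))

  ∑-+ : ∀ xs (f g : A → ℕ) → ∑ xs (λ x → f x + g x) ≡ ∑ xs f + ∑ xs g
  ∑-+ []       f g = refl
  ∑-+ (x ∷ xs) f g = trans (cong (f x + g x +_) (∑-+ xs f g))
    (solve 4 (λ a b c d → (a :+ b) :+ (c :+ d) := (a :+ c) :+ (b :+ d)) refl (f x) (g x) _ _)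
    where open +-*-Solver

  ∑-*ˡ : ∀ c xs (f : A → ℕ) → ∑ xs (λ x → c * f x) ≡ c * ∑ xs f
  ∑-*ˡ c []       f = sym (*-zeroʳ c)
  ∑-*ˡ c (x ∷ xs) f = trans (cong (c * f x +_) (∑-*ˡ c xs f)) (sym (*-distribˡ-+ c (f x) _))

  ∑-*ʳ : ∀ c xs (f : A → ℕ) → ∑ xs (λ x → f x * c) ≡ ∑ xs f * c
  ∑-*ʳ c xs f = trans (∑-cong xs λ x → *-comm (f x) c) (trans (∑-*ˡ c xs f) (*-comm c _))

  ∑-zero : ∀ xs → ∑ xs (λ _ → 0) ≡ 0
  ∑-zero []       = refl
  ∑-zero (x ∷ xs) = ∑-zero xs

  ∑-one : ∀ xs → ∑ xs (λ _ → 1) ≡ length xs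
  ∑-one []       = refl
  ∑-one (x ∷ xs) = cong suc (∑-one xs)

  -- If every positive g x were smaller than f x, then ∑ f would exceed ∑ g.
  ∑-select : ∀ xs (f g : A → ℕ) → ∑ xs f ≤ ∑ xs g → 0 < ∑ xs g → ∃[ x ] (f x ≤ g x × 0 < g x)
  ∑-select (x ∷ xs) f g f≤g 0<g with 0 <? g x | f x ≤? g x
  ... | yes 0<gx | yes fx≤gx = x , fx≤gx , 0<gx
  ... | no  0≮gx | _         = ∑-select xs f g (≤-trans (m≤n+m _ (f x)) (subst (λ z → _ ≤ z + ∑ xs g) gx≡0 f≤g))
      (subst (λ z → 0 < z + ∑ xs g) gx≡0 0<g)
    where
    gx≡0 : g x ≡ 0
    gx≡0 = n≤0⇒n≡0 (≮⇒≥ 0≮gx)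
  ... | yes _    | no  fx≰gx = ∑-select xs f g (<⇒≤ f<g) (≤-<-trans z≤n f<g)
    where
    f<g : ∑ xs f < ∑ xs g
    f<g = +-cancelˡ-< (g x) _ _ (<-≤-trans (+-monoˡ-< (∑ xs f) (≰⇒> fx≰gx)) f≤g)

  module _ {P : A → Set} (P? : Decidable P) where

    length-filter-∑ : ∀ xs → length (filter P? xs) ≡ ∑ xs (λ x → ind (P? x))
    length-filter-∑ [] = refl
    length-filter-∑ (x ∷ xs) with does (P? x)
    ... | true  = cong suc (length-filter-∑ xs)
    ... | false = length-filter-∑ xs

    length-filter-¬ : ∀ xs → length (filter P? xs) + length (filter (λ x → ¬? (P? x)) xs) ≡ length xs
    length-filter-¬ [] = refl
    length-filter-¬ (x ∷ xs) with does (P? x)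
    ... | true  = cong suc (length-filter-¬ xs)
    ... | false = trans (+-suc _ _) (cong suc (length-filter-¬ xs))

module _ {A B : Set} where

  ∑-swap : ∀ (xs : List A) (ys : List B) (f : A → B → ℕ) →
    ∑ xs (λ x → ∑ ys (f x)) ≡ ∑ ys (λ y → ∑ xs (λ x → f x y))
  ∑-swap []       ys f = sym (∑-zero ys)
  ∑-swap (x ∷ xs) ys f = trans (cong (∑ ys (f x) +_) (∑-swap xs ys f)) (sym (∑-+ ys (f x) _))

  ∑-map : ∀ (h : A → B) xs (f : B → ℕ) → ∑ (map h xs) f ≡ ∑ xs (f ∘ h)
  ∑-map h xs f = cong sum (sym (map-∘ xs))

∑-cartesianProductWith : ∀ {A B C : Set} (h : A → B → C) xs ys (f : C → ℕ) →
  ∑ (cartesianProductWith h xs ys) f ≡ ∑ xs (λ x → ∑ ys (λ y → f (h x y)))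
∑-cartesianProductWith h []       ys f = refl
∑-cartesianProductWith h (x ∷ xs) ys f = trans (∑-++ (map (h x) ys) _ f)
  (cong₂ _+_ (∑-map (h x) ys f) (∑-cartesianProductWith h xs ys f))

∑< : ℕ → (ℕ → ℕ) → ℕ
∑< n f = sum (applyUpTo f n)

∑-upTo : ∀ n f → ∑ (upTo n) f ≡ ∑< n f
∑-upTo n f = cong sum (map-upTo f n)

∑-allFin : ∀ n f → ∑ (allFin n) (f ∘ toℕ) ≡ ∑< n f
∑-allFin n f = trans (cong sum (map-tabulate {n = n} (λ i → i) (f ∘ toℕ))) (go n f)
  where
  go : ∀ n f → sum (tabulate {n = n} (f ∘ toℕ)) ≡ ∑< n f
  go zero    f = refl
  go (suc n) f = cong (f 0 +_) (go n (f ∘ suc))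

∑<-cong : ∀ n {f g} → (∀ i → i < n → f i ≡ g i) → ∑< n f ≡ ∑< n g
∑<-cong zero    f≗g = refl
∑<-cong (suc n) f≗g = cong₂ _+_ (f≗g 0 z<s) (∑<-cong n λ i i<n → f≗g (suc i) (s<s i<n))

∑<-split : ∀ m n f → ∑< (m + n) f ≡ ∑< m f + ∑< n (λ i → f (m + i))
∑<-split zero    n f = refl
∑<-split (suc m) n f = trans (cong (f 0 +_) (∑<-split m n (f ∘ suc))) (sym (+-assoc (f 0) _ _))

∑<-const : ∀ n c → ∑< n (λ _ → c) ≡ n * c
∑<-const zero    c = refl
∑<-const (suc n) c = cong (c +_) (∑<-const n c)

∑<-last : ∀ n (f : ℕ → ℕ) → ∑< (suc n) f ≡ ∑< n f + f n
∑<-last zero    f = +-identityʳ (f 0)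
∑<-last (suc n) f = trans (cong (f 0 +_) (∑<-last n (f ∘ suc))) (sym (+-assoc (f 0) _ _))

∑<-reverse : ∀ n (f : ℕ → ℕ) → ∑< n (λ i → f (n ∸ i)) ≡ ∑< n (λ i → f (suc i))
∑<-reverse zero    f = refl
∑<-reverse (suc n) f = trans (cong (f (suc n) +_) (∑<-reverse n f))
  (trans (+-comm (f (suc n)) _) (sym (∑<-last n (λ i → f (suc i)))))

∑<-*ˡ : ∀ n c (f : ℕ → ℕ) → ∑< n (λ i → c * f i) ≡ c * ∑< n f
∑<-*ˡ zero    c f = sym (*-zeroʳ c)
∑<-*ˡ (suc n) c f = trans (cong (c * f 0 +_) (∑<-*ˡ n c (f ∘ suc))) (sym (*-distribˡ-+ c (f 0) _))

-- Indicators and the sums they cut out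

ind-yes : {P : Set} (p? : Dec P) → P → ind p? ≡ 1
ind-yes (yes _) _ = refl
ind-yes (no ¬p) p = contradiction p ¬p

ind-no : {P : Set} (p? : Dec P) → ¬ P → ind p? ≡ 0
ind-no (yes p) ¬p = contradiction p ¬p
ind-no (no _)  _  = refl

ind-≤ : {P : Set} (p? : Dec P) {n : ℕ} → (P → 1 ≤ n) → ind p? ≤ n
ind-≤ (yes p) f = f p
ind-≤ (no _)  f = z≤n

ind-× : {P Q : Set} (p? : Dec P) (q? : Dec Q) → ind (p? ×-dec q?) ≡ ind p? * ind q?
ind-× (yes _) (yes _) = refl
ind-× (yes _) (no _)  = refl
ind-× (no _)  _       = refl

∑<-ind-≤ : ∀ {n k} (f : ℕ → ℕ) → k < n → ∑< n (λ s → f s * ind (s ≤? k)) ≡ ∑< (suc k) f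
∑<-ind-≤ {n} {k} f k<n = begin
  ∑< n g                                            ≡⟨ cong (λ z → ∑< z g) (m+[n∸m]≡n k<n) ⟨
  ∑< (suc k + (n ∸ suc k)) g                        ≡⟨ ∑<-split (suc k) (n ∸ suc k) g ⟩
  ∑< (suc k) g + ∑< (n ∸ suc k) (λ i → g (suc k + i)) ≡⟨ cong₂ _+_ (∑<-cong (suc k) below) (∑<-cong (n ∸ suc k) above) ⟩
  ∑< (suc k) f + ∑< (n ∸ suc k) (λ _ → 0)
    ≡⟨ cong (∑< (suc k) f +_) (trans (∑<-const (n ∸ suc k) 0) (*-zeroʳ (n ∸ suc k))) ⟩
  ∑< (suc k) f + 0                                  ≡⟨ +-identityʳ _ ⟩
  ∑< (suc k) f                                      ∎
  where
  open ≡-Reasoning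
  g : ℕ → ℕ
  g s = f s * ind (s ≤? k)
  below : ∀ i → i < suc k → g i ≡ f i
  below i i≤k = trans (cong (f i *_) (ind-yes (i ≤? k) (≤-pred i≤k))) (*-identityʳ (f i))
  above : ∀ i → i < n ∸ suc k → g (suc k + i) ≡ 0
  above i _ = trans (cong (f (suc k + i) *_) (ind-no (suc k + i ≤? k) (<⇒≱ (s≤s (m≤m+n k i))))) (*-zeroʳ (f (suc k + i)))

∑<-ind-≟ : ∀ {n k} (f : ℕ → ℕ) → k < n → ∑< n (λ s → f s * ind (s ≟ k)) ≡ f k
∑<-ind-≟ {suc n} {zero} f _ = begin
  f 0 * 1 + ∑< n (λ s → f (suc s) * 0)  ≡⟨ cong₂ _+_ (*-identityʳ (f 0)) (∑<-cong n λ s _ → *-zeroʳ (f (suc s))) ⟩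
  f 0 + ∑< n (λ _ → 0)                  ≡⟨ cong (f 0 +_) (trans (∑<-const n 0) (*-zeroʳ n)) ⟩
  f 0 + 0                               ≡⟨ +-identityʳ (f 0) ⟩
  f 0                                   ∎
  where open ≡-Reasoning
∑<-ind-≟ {suc n} {suc k} f (s≤s k<n) = cong₂ _+_ (*-zeroʳ (f 0)) (∑<-ind-≟ (f ∘ suc) k<n)

-- Truncated cyclic distance

∣-∣-sucˡ : ∀ x t → ∣ x - t ∣ ≤ suc ∣ suc x - t ∣ × ∣ suc x - t ∣ ≤ suc ∣ x - t ∣
∣-∣-sucˡ x       zero    = subst (λ z → z ≤ 2 + x × suc x ≤ suc z) (sym (∣-∣-identityʳ x)) (m≤n+m x 2 , ≤-refl)
∣-∣-sucˡ zero    (suc t) = ≤-refl , ≤-trans (n≤1+n t) (n≤1+n (suc t))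
∣-∣-sucˡ (suc x) (suc t) = ∣-∣-sucˡ x t

module Distance (m N : ℕ) where

  -- On offsets `r` between 0 and `m` this is the truncated distance from `r` to 0 around the cycle.
  -- Its symmetry under `r` to `m ∸ r` lets `δ` use the plain absolute difference, with no reduction
  -- modulo `m`.
  φ : ℕ → ℕ
  φ r = N ⊓ (r ⊓ (m ∸ r))

  φ-sym : ∀ {r} → r ≤ m → φ (m ∸ r) ≡ φ r
  φ-sym {r} r≤m = cong (N ⊓_) (trans (cong ((m ∸ r) ⊓_) (m∸[m∸n]≡n r≤m)) (⊓-comm (m ∸ r) r))

  φ-Lipschitz : ∀ {r r′} → r ≤ suc r′ → r′ ≤ suc r → φ r ≤ suc (φ r′)
  φ-Lipschitz {r} {r′} r≤ r′≤ = ⊓-mono-≤ (n≤1+n N) (⊓-mono-≤ r≤ (begin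
    m ∸ r            ≤⟨ m≤n+m∸n (m ∸ r) 1 ⟩
    suc (m ∸ r ∸ 1)  ≡⟨ cong suc (trans (∸-+-assoc m r 1) (cong (m ∸_) (+-comm r 1))) ⟩
    suc (m ∸ suc r)  ≤⟨ s≤s (∸-monoʳ-≤ m r′≤) ⟩
    suc (m ∸ r′)     ∎))
    where open ≤-Reasoning

  δ : Fin m → Fin m → ℕ
  δ x t = φ ∣ toℕ x - toℕ t ∣

  δ≤N : ∀ x t → δ x t ≤ N
  δ≤N x t = m⊓n≤m N _

  δ-refl : ∀ t → δ t t ≡ 0
  δ-refl t = trans (cong φ (∣n-n∣≡0 (toℕ t))) (⊓-zeroʳ N)

  δ-CStep : ∀ {x y} → CStep m x y → ∀ t → δ x t ≤ suc (δ y t) × δ y t ≤ suc (δ x t)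
  δ-CStep {x} {y} (inj₁ 1+x≡y) t rewrite sym 1+x≡y =
    let p , q = ∣-∣-sucˡ (toℕ x) (toℕ t) in φ-Lipschitz p q , φ-Lipschitz q p
  -- On the edge that closes the cycle, the offset `t` of the vertex 0 is replaced by its complement
  -- `m ∸ t`, which is one more than the offset `x ∸ t` of the other endpoint.
  δ-CStep {x} {y} (inj₂ (1+x≡m , y≡0)) t
    rewrite y≡0 | m≤n⇒∣n-m∣≡n∸m (≤-pred (subst (toℕ t <_) (sym 1+x≡m) (toℕ<n t))) | sym (φ-sym (<⇒≤ (toℕ<n t))) =
    φ-Lipschitz p q , φ-Lipschitz q p
    where
    t≤x : toℕ t ≤ toℕ x
    t≤x = ≤-pred (subst (toℕ t <_) (sym 1+x≡m) (toℕ<n t))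
    m∸t : m ∸ toℕ t ≡ suc (toℕ x ∸ toℕ t)
    m∸t = trans (cong (_∸ toℕ t) (sym 1+x≡m)) (+-∸-assoc 1 t≤x)
    p : toℕ x ∸ toℕ t ≤ suc (m ∸ toℕ t)
    p = ≤-trans (∸-monoˡ-≤ (toℕ t) (<⇒≤ (toℕ<n x))) (n≤1+n _)
    q : m ∸ toℕ t ≤ suc (toℕ x ∸ toℕ t)
    q = ≤-reflexive m∸t

  δ-CAdj : ∀ {x y} → CAdj m x y → ∀ t → δ x t ≤ suc (δ y t)
  δ-CAdj (inj₁ s) t = let p , _ = δ-CStep s t in p
  δ-CAdj (inj₂ s) t = let _ , p = δ-CStep s t in p

  -- The cycle is homogeneous: replacing the offset `k ∸ t` by its complement for `t < k` makes the
  -- offsets run once through 0, ..., m - 1. Averages over the centre therefore do not depend on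
  -- `x`.
  ∑-δ-rotate : ∀ x (g : ℕ → ℕ) → ∑ (allFin m) (λ t → g (δ x t)) ≡ ∑< m (g ∘ φ)
  ∑-δ-rotate x g = begin
    ∑ (allFin m) (λ t → g (δ x t))                                      ≡⟨ ∑-allFin m (λ t → g (φ ∣ k - t ∣)) ⟩
    ∑< m (λ t → g (φ ∣ k - t ∣))
      ≡⟨ cong (λ n → ∑< n (λ t → g (φ ∣ k - t ∣))) (m+[n∸m]≡n k≤m) ⟨
    ∑< (k + (m ∸ k)) (λ t → g (φ ∣ k - t ∣))                            ≡⟨ ∑<-split k (m ∸ k) _ ⟩
    ∑< k (λ t → g (φ ∣ k - t ∣)) + ∑< (m ∸ k) (λ r → g (φ ∣ k - k + r ∣))
      ≡⟨ cong₂ _+_ (∑<-cong k below) (∑<-cong (m ∸ k) λ r _ → cong (g ∘ φ) (∣m-m+n∣≡n k r)) ⟩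
    ∑< k (λ r → g (φ (m ∸ k + r))) + ∑< (m ∸ k) (g ∘ φ)                 ≡⟨ +-comm (∑< k _) _ ⟩
    ∑< (m ∸ k) (g ∘ φ) + ∑< k (λ r → g (φ (m ∸ k + r)))                 ≡⟨ ∑<-split (m ∸ k) k (g ∘ φ) ⟨
    ∑< (m ∸ k + k) (g ∘ φ)                                              ≡⟨ cong (λ n → ∑< n (g ∘ φ)) (m∸n+n≡m k≤m) ⟩
    ∑< m (g ∘ φ)                                                        ∎
    where
    open ≡-Reasoning
    k = toℕ x
    k≤m : k ≤ m
    k≤m = <⇒≤ (toℕ<n x)
    below : ∀ t → t < k → g (φ ∣ k - t ∣) ≡ g (φ (m ∸ k + t))
    below t t<k = cong g (begin
      φ ∣ k - t ∣      ≡⟨ cong φ (m≤n⇒∣n-m∣≡n∸m (<⇒≤ t<k)) ⟩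
      φ (k ∸ t)        ≡⟨ φ-sym (≤-trans (m∸n≤m k t) k≤m) ⟨
      φ (m ∸ (k ∸ t))  ≡⟨ cong φ (begin
        m ∸ (k ∸ t)            ≡⟨ cong (_∸ (k ∸ t)) (m∸n+n≡m k≤m) ⟨
        m ∸ k + k ∸ (k ∸ t)    ≡⟨ +-∸-assoc (m ∸ k) (m∸n≤m k t) ⟩
        m ∸ k + (k ∸ (k ∸ t))  ≡⟨ cong (m ∸ k +_) (m∸[m∸n]≡n (<⇒≤ t<k)) ⟩
        m ∸ k + t              ∎) ⟩
      φ (m ∸ k + t)    ∎)

  -- Around the cycle the profile of `φ` rises through 0, ..., N, stays at N for `p` further
  -- offsets, and falls through N, ..., 1.
  ∑<-φ : ∀ p → m ≡ suc N + (p + N) → ∀ (g : ℕ → ℕ) →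
    ∑< m (g ∘ φ) ≡ g 0 + (2 * ∑< N (λ j → g (suc j)) + p * g N)
  ∑<-φ p m≡ g = begin
    ∑< m (g ∘ φ)                                                        ≡⟨ cong (λ n → ∑< n (g ∘ φ)) m≡ ⟩
    ∑< (suc N + (p + N)) (g ∘ φ)                                        ≡⟨ ∑<-split (suc N) (p + N) (g ∘ φ) ⟩
    ∑< (suc N) (g ∘ φ) + ∑< (p + N) (λ i → g (φ (suc N + i)))           ≡⟨ cong (∑< (suc N) (g ∘ φ) +_) (∑<-split p N _) ⟩
    ∑< (suc N) (g ∘ φ) + (∑< p (λ i → g (φ (suc N + i))) + ∑< N (λ i → g (φ (suc N + (p + i)))))
      ≡⟨ cong₂ _+_ (∑<-cong (suc N) λ i i<N → cong g (rising i (≤-pred i<N)))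
           (cong₂ _+_ (∑<-cong p λ i i<p → cong g (flat i i<p)) (∑<-cong N λ i i<N → cong g (falling i i<N))) ⟩
    g 0 + ∑< N (λ j → g (suc j)) + (∑< p (λ _ → g N) + ∑< N (λ i → g (N ∸ i)))
      ≡⟨ cong (λ z → g 0 + ∑< N (λ j → g (suc j)) + z) (cong₂ _+_ (∑<-const p (g N)) (∑<-reverse N g)) ⟩
    g 0 + ∑< N (λ j → g (suc j)) + (p * g N + ∑< N (λ j → g (suc j)))
      ≡⟨ solve 3 (λ a s q → a :+ s :+ (q :+ s) := a :+ (con 2 :* s :+ q)) refl (g 0) (∑< N (λ j → g (suc j))) (p * g N) ⟩
    g 0 + (2 * ∑< N (λ j → g (suc j)) + p * g N) ∎
    where
    open ≡-Reasoning
    open +-*-Solver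
    φ-at : ∀ r c → m ≡ r + c → φ r ≡ N ⊓ (r ⊓ c)
    φ-at r c eq = cong (λ z → N ⊓ (r ⊓ z)) (trans (cong (_∸ r) eq) (m+n∸m≡n r c))
    rising : ∀ i → i ≤ N → φ i ≡ i
    rising i i≤N = trans (φ-at i (suc (N ∸ i) + (p + N)) (trans m≡ eq))
      (trans (cong (N ⊓_) (m≤n⇒m⊓n≡m (≤-trans i≤N (≤-trans (m≤n+m N p) (m≤n+m (p + N) (suc (N ∸ i))))))) (m≥n⇒m⊓n≡n i≤N))
      where
      eq : suc N + (p + N) ≡ i + (suc (N ∸ i) + (p + N))
      eq = trans (cong (λ z → suc z + (p + N)) (sym (m+[n∸m]≡n i≤N)))
        (solve 4 (λ i a p n → con 1 :+ (i :+ a) :+ (p :+ n) := i :+ (con 1 :+ a :+ (p :+ n))) refl i (N ∸ i) p N)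
    flat : ∀ i → i < p → φ (suc N + i) ≡ N
    flat i i<p = trans (φ-at (suc N + i) (p ∸ i + N) (trans m≡ eq))
      (m≤n⇒m⊓n≡m (⊓-glb (≤-trans (n≤1+n N) (m≤m+n (suc N) i)) (m≤n+m N (p ∸ i))))
      where
      eq : suc N + (p + N) ≡ suc N + i + (p ∸ i + N)
      eq = trans (cong (λ z → suc N + (z + N)) (sym (m+[n∸m]≡n (<⇒≤ i<p))))
        (solve 3 (λ i a n → con 1 :+ n :+ (i :+ a :+ n) := con 1 :+ n :+ i :+ (a :+ n)) refl i (p ∸ i) N)
    falling : ∀ i → i < N → φ (suc N + (p + i)) ≡ N ∸ i
    falling i i<N = trans (φ-at (suc N + (p + i)) (N ∸ i) (trans m≡ eq))
      (trans (cong (N ⊓_) (m≥n⇒m⊓n≡n (≤-trans (m∸n≤m N i) (≤-trans (n≤1+n N) (m≤m+n (suc N) _))))) (m≥n⇒m⊓n≡n (m∸n≤m N i)))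
      where
      eq : suc N + (p + N) ≡ suc N + (p + i) + (N ∸ i)
      eq = trans (cong (λ z → suc N + (p + z)) (sym (m+[n∸m]≡n (<⇒≤ i<N))))
        (solve 4 (λ i a p n → con 1 :+ n :+ (p :+ (i :+ a)) := con 1 :+ n :+ (p :+ i) :+ a) refl i (N ∸ i) p N)

-- Vertices and cycles

vertices : ∀ m d → List (Vertex m d)
vertices m zero    = [] ∷ []
vertices m (suc d) = cartesianProductWith _∷_ (allFin m) (vertices m d)

∑-vertices-suc : ∀ m d (f : Vertex m (suc d) → ℕ) →
  ∑ (vertices m (suc d)) f ≡ ∑ (allFin m) (λ t → ∑ (vertices m d) (λ ts → f (t ∷ ts)))
∑-vertices-suc m d f = ∑-cartesianProductWith _∷_ (allFin m) (vertices m d) f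

∑-vertices-* : ∀ m d (f : Fin m → ℕ) (g : Vertex m d → ℕ) →
  ∑ (allFin m) (λ t → ∑ (vertices m d) (λ ts → f t * g ts)) ≡ ∑ (allFin m) f * ∑ (vertices m d) g
∑-vertices-* m d f g = trans (∑-cong (allFin m) λ t → ∑-*ˡ (f t) (vertices m d) g) (∑-*ʳ _ (allFin m) f)

vertices-unique : ∀ m d → Unique (vertices m d)
vertices-unique m zero    = [] ∷ []
vertices-unique m (suc d) = cartesianProductWith⁺ _∷_ ∷-injective (allFin⁺ m) (vertices-unique m d)

∈-vertices : ∀ {m d} (x : Vertex m d) → x ∈ vertices m d
∈-vertices []       = here refl
∈-vertices (x ∷ xs) = ∈-cartesianProductWith⁺ _∷_ (∈-allFin x) (∈-vertices xs)

length-vertices : ∀ m d → length (vertices m d) ≡ m ^ d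
length-vertices m zero    = refl
length-vertices m (suc d) = begin
  length (vertices m (suc d))                           ≡⟨ ∑-one (vertices m (suc d)) ⟨
  ∑ (vertices m (suc d)) (λ _ → 1)                      ≡⟨ ∑-vertices-suc m d (λ _ → 1) ⟩
  ∑ (allFin m) (λ _ → ∑ (vertices m d) (λ _ → 1))       ≡⟨ ∑-allFin m (λ _ → ∑ (vertices m d) (λ _ → 1)) ⟩
  ∑< m (λ _ → ∑ (vertices m d) (λ _ → 1))               ≡⟨ ∑<-const m _ ⟩
  m * ∑ (vertices m d) (λ _ → 1)                        ≡⟨ cong (m *_) (trans (∑-one (vertices m d)) (length-vertices m d)) ⟩
  m * m ^ d                                             ∎
  where open ≡-Reasoning

-- In the coordinate whose projection is full, some edge of the cycle covers the edge of C_m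
-- starting at the prescribed value. The endpoint taking that value may be the later one, hence
-- `k ≤ len C` rather than a strict bound.
nontrivial-meets : ∀ {m d} (C : Cycle m d) → Nontrivial m d C → (t : Vertex m d) →
  ∃[ k ] (k ≤ len C × ∃[ c ] (lookup (vtx C k) c ≡ lookup t c))
nontrivial-meets C (c , covers) t with covers (lookup t c)
... | k , k<len , _ , _ , inj₁ (eq , _) = k , <⇒≤ k<len , c , eq
... | k , k<len , _ , _ , inj₂ (_ , eq) = suc k , k<len , c , eq

Adj-sym : ∀ {m d} (x y : Vertex m d) → Adj m d x y → Adj m d y x
Adj-sym x y (i , inj₁ s , eq) = i , inj₂ s , λ j j≢i → sym (eq j j≢i)
Adj-sym x y (i , inj₂ s , eq) = i , inj₁ s , λ j j≢i → sym (eq j j≢i)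

-- Cells and their boundaries

-- Telescoping of the powers of a/b with a = b + 1, where consecutive powers differ by a^i /
-- b^(i+1); everything is multiplied by `b ^ D`.
geometric-∑ : ∀ b D n → n ≤ D → b ^ D + ∑< n (λ i → suc b ^ i * b ^ (D ∸ suc i)) ≡ suc b ^ n * b ^ (D ∸ n)
geometric-∑ b D zero    _   = refl
geometric-∑ b D (suc n) n<D = begin
  b ^ D + ∑< (suc n) f         ≡⟨ cong (b ^ D +_) (∑<-last n f) ⟩
  b ^ D + (∑< n f + f n)       ≡⟨ +-assoc (b ^ D) _ _ ⟨
  b ^ D + ∑< n f + f n         ≡⟨ cong (_+ f n) (geometric-∑ b D n (<⇒≤ n<D)) ⟩
  A * b ^ (D ∸ n) + f n        ≡⟨ cong (λ z → A * b ^ z + f n) (+-∸-assoc 1 n<D) ⟩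
  A * (b * B) + A * B          ≡⟨ solve 3 (λ a b c → a :* (b :* c) :+ a :* c := (con 1 :+ b) :* a :* c) refl A b B ⟩
  suc b * A * B                ∎
  where
  open ≡-Reasoning
  open +-*-Solver
  f : ℕ → ℕ
  f i = suc b ^ i * b ^ (D ∸ suc i)
  A = suc b ^ n
  B = b ^ (D ∸ suc n)

module Cells (m N b : ℕ) where

  open Distance m N public

  a : ℕ
  a = suc b

  -- (a/b)^j scaled by b^N to stay integral, and killed at distance 0.
  h : ℕ → ℕ
  h zero    = 0
  h (suc j) = a ^ suc j * b ^ (N ∸ suc j)

  ∑δ : (ℕ → ℕ) → ∀ {d} → Vertex m d → Vertex m d → ℕ
  ∑δ g []       []       = 0
  ∑δ g (x ∷ xs) (t ∷ ts) = g (δ x t) + ∑δ g xs ts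

  σ near : ∀ {d} → Vertex m d → Vertex m d → ℕ
  σ    = ∑δ (λ j → j)
  near = ∑δ (λ j → ind (j ≟ 1))

  -- The product form is what makes sums over all centres factorise over the coordinates. A single
  -- coordinate at distance 0 makes the product vanish.
  F : ∀ {d} → Vertex m d → Vertex m d → ℕ
  F []       []       = 1
  F (x ∷ xs) (t ∷ ts) = h (δ x t) * F xs ts

  Off : ∀ {d} → Vertex m d → Vertex m d → Set
  Off x t = ∀ i → 1 ≤ δ (lookup x i) (lookup t i)

  off? : ∀ {d} (x t : Vertex m d) → Dec (Off x t)
  off? x t = all? (λ i → 1 ≤? δ (lookup x i) (lookup t i))

  σ≤ : ∀ {d} (x t : Vertex m d) → σ x t ≤ d * N
  σ≤ []       []       = z≤n
  σ≤ (x ∷ xs) (t ∷ ts) = +-mono-≤ (δ≤N x t) (σ≤ xs ts)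

  F-Off : ∀ {d} (x t : Vertex m d) → Off x t → F x t ≡ a ^ σ x t * b ^ (d * N ∸ σ x t)
  F-Off []       []       _   = refl
  F-Off {suc d} (x ∷ xs) (t ∷ ts) off = begin
    h j * F xs ts                                   ≡⟨ cong₂ _*_ (h-pos j (off zero)) (F-Off xs ts (off ∘ suc)) ⟩
    a ^ j * b ^ (N ∸ j) * (a ^ s * b ^ (d * N ∸ s))
      ≡⟨ solve 4 (λ p q r t → p :* q :* (r :* t) := p :* r :* (q :* t)) refl (a ^ j) (b ^ (N ∸ j)) (a ^ s) _ ⟩
    a ^ j * a ^ s * (b ^ (N ∸ j) * b ^ (d * N ∸ s))
      ≡⟨ cong₂ _*_ (^-distribˡ-+-* a j s) (^-distribˡ-+-* b (N ∸ j) (d * N ∸ s)) ⟨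
    a ^ (j + s) * b ^ (N ∸ j + (d * N ∸ s))         ≡⟨ cong (λ z → a ^ (j + s) * b ^ z) exponent ⟩
    a ^ (j + s) * b ^ (N + d * N ∸ (j + s))         ∎
    where
    open ≡-Reasoning
    open +-*-Solver
    j = δ x t
    s = σ xs ts
    h-pos : ∀ j → 1 ≤ j → h j ≡ a ^ j * b ^ (N ∸ j)
    h-pos (suc j) _ = refl
    exponent : N ∸ j + (d * N ∸ s) ≡ N + d * N ∸ (j + s)
    exponent = begin
      N ∸ j + (d * N ∸ s)   ≡⟨ +-∸-assoc (N ∸ j) (σ≤ xs ts) ⟨
      N ∸ j + d * N ∸ s     ≡⟨ cong (_∸ s) (+-∸-comm (d * N) (δ≤N x t)) ⟨
      N + d * N ∸ j ∸ s     ≡⟨ ∸-+-assoc (N + d * N) j s ⟩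
      N + d * N ∸ (j + s)   ∎

  F-¬Off : ∀ {d} (x t : Vertex m d) → ¬ Off x t → F x t ≡ 0
  F-¬Off []       []       ¬off = contradiction (λ ()) ¬off
  F-¬Off (x ∷ xs) (t ∷ ts) ¬off with δ x t in eq
  ... | zero  = refl
  ... | suc j = trans (cong (h (suc j) *_) (F-¬Off xs ts λ off →
    ¬off λ { zero → subst (1 ≤_) (sym eq) (s≤s z≤n) ; (suc i) → off i })) (*-zeroʳ (h (suc j)))

  module Levels (d : ℕ) where

    -- Weights for which the level sets of F are averaged: F x t is the sum of the w s with s ≤ σ x t.
    w : ℕ → ℕ
    w zero    = b ^ (d * N)
    w (suc s) = a ^ s * b ^ (d * N ∸ suc s)

    -- The two alternatives in `Boundary` are the two ways in which one step can leave the cell: `σ`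
    -- drops below `s`, or a coordinate reaches the value of the centre.
    Cell Boundary : Vertex m d → ℕ → Vertex m d → Set
    Cell t s x     = Off x t × s ≤ σ x t
    Boundary t s x = Cell t s x × (s ≡ σ x t ⊎ 1 ≤ near x t)

    cell? : ∀ t s x → Dec (Cell t s x)
    cell? t s x = off? x t ×-dec (s ≤? σ x t)

    boundary? : ∀ t s x → Dec (Boundary t s x)
    boundary? t s x = cell? t s x ×-dec ((s ≟ σ x t) ⊎-dec (1 ≤? near x t))

    levels : List ℕ
    levels = upTo (suc (d * N))

    cell-weight : ∀ t x → ∑ levels (λ s → w s * ind (cell? t s x)) ≡ F x t
    cell-weight t x with off? x t
    ... | yes off = begin
      ∑ levels (λ s → w s * ind (cell? t s x))        ≡⟨ ∑-cong levels (λ s → cong (w s *_)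
        (trans (ind-× (off? x t) (s ≤? σ x t)) (trans (cong (_* ind (s ≤? σ x t)) (ind-yes (off? x t) off)) (*-identityˡ _)))) ⟩
      ∑ levels (λ s → w s * ind (s ≤? σ x t))         ≡⟨ ∑-upTo (suc (d * N)) _ ⟩
      ∑< (suc (d * N)) (λ s → w s * ind (s ≤? σ x t)) ≡⟨ ∑<-ind-≤ w (s≤s (σ≤ x t)) ⟩
      ∑< (suc (σ x t)) w                              ≡⟨ geometric-∑ b (d * N) (σ x t) (σ≤ x t) ⟩
      a ^ σ x t * b ^ (d * N ∸ σ x t)                 ≡⟨ F-Off x t off ⟨
      F x t                                           ∎
      where open ≡-Reasoning
    ... | no ¬off = trans (trans (∑-cong levels λ s → trans (cong (w s *_) (ind-no (cell? t s x) (¬off ∘ proj₁))) (*-zeroʳ (w s)))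
      (∑-zero levels)) (sym (F-¬Off x t ¬off))

    -- A union bound. The alternative `s ≡ σ x t` meets only one level, whose weight is 1/a of
    -- `F x t`; the other is bounded by `near x t` times the whole cell. The first needs `σ x t` to
    -- be positive, because `w 0` does not follow the pattern of the other weights; `Off` together
    -- with `1 ≤ d` guarantees this.
    boundary-weight : 1 ≤ d → ∀ t x →
      a * ∑ levels (λ s → w s * ind (boundary? t s x)) ≤ F x t + a * (near x t * F x t)
    boundary-weight 1≤d t x = begin
      a * ∑ levels (λ s → w s * ind (boundary? t s x))
        ≤⟨ *-monoʳ-≤ a (∑-mono levels bound) ⟩
      a * ∑ levels (λ s → f s + g s)
        ≡⟨ cong (a *_) (∑-+ levels f g) ⟩
      a * (∑ levels f + ∑ levels g)
        ≡⟨ cong (a *_) (cong₂ _+_ (trans (∑-*ˡ o levels _) (cong (o *_) (trans (∑-upTo (suc (d * N)) _) (∑<-ind-≟ w (s≤s (σ≤ x t))))))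
             (trans (∑-*ˡ (near x t) levels _) (cong (near x t *_) (cell-weight t x)))) ⟩
      a * (o * w (σ x t) + near x t * F x t)
        ≡⟨ *-distribˡ-+ a (o * w (σ x t)) _ ⟩
      a * (o * w (σ x t)) + a * (near x t * F x t)
        ≤⟨ +-monoˡ-≤ _ single ⟩
      F x t + a * (near x t * F x t) ∎
      where
      open ≤-Reasoning
      o = ind (off? x t)
      f g : ℕ → ℕ
      f s = o * (w s * ind (s ≟ σ x t))
      g s = near x t * (w s * ind (cell? t s x))
      bound : ∀ s → w s * ind (boundary? t s x) ≤ f s + g s
      bound s = ≤-trans (*-monoʳ-≤ (w s) pointwise) (≤-reflexive
        (solve 5 (λ w o i n c → w :* (o :* i :+ n :* c) := o :* (w :* i) :+ n :* (w :* c))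
          refl (w s) o (ind (s ≟ σ x t)) (near x t) (ind (cell? t s x))))
        where
        open +-*-Solver
        pointwise : ind (boundary? t s x) ≤ o * ind (s ≟ σ x t) + near x t * ind (cell? t s x)
        pointwise = ind-≤ (boundary? t s x) λ where
          ((off , _) , inj₁ s≡σ) → ≤-trans
            (≤-reflexive (sym (cong₂ _*_ (ind-yes (off? x t) off) (ind-yes (s ≟ σ x t) s≡σ)))) (m≤m+n _ _)
          (c , inj₂ 1≤n) → ≤-trans
            (*-mono-≤ 1≤n (≤-reflexive (sym (ind-yes (cell? t s x) c)))) (m≤n+m _ _)
      single : a * (o * w (σ x t)) ≤ F x t
      single with off? x t
      ... | no ¬off = ≤-trans (≤-reflexive (trans (cong (λ z → a * (z * w (σ x t))) (ind-no (off? x t) ¬off)) (*-zeroʳ a))) z≤n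
      ... | yes off = ≤-reflexive (trans (cong (λ z → a * (z * w (σ x t))) (ind-yes (off? x t) off))
        (trans (level (σ x t) (1≤σ 1≤d x t off)) (sym (F-Off x t off))))
        where
        1≤σ : ∀ {d} → 1 ≤ d → (x t : Vertex m d) → Off x t → 1 ≤ σ x t
        1≤σ _ (x ∷ xs) (t ∷ ts) off = ≤-trans (off zero) (m≤m+n _ _)
        level : ∀ s → 1 ≤ s → a * (1 * w s) ≡ a ^ s * b ^ (d * N ∸ s)
        level (suc s) _ = trans (cong (a *_) (*-identityˡ (w (suc s)))) (sym (*-assoc a (a ^ s) _))

-- How nontrivial cycles meet cells

module CellGeometry (m N b : ℕ) where

  open Cells m N b public

  ∑δ-lookup : ∀ g {d} (x t : Vertex m d) i → g (δ (lookup x i) (lookup t i)) ≤ ∑δ g x t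
  ∑δ-lookup g (x ∷ xs) (t ∷ ts) zero    = m≤m+n _ _
  ∑δ-lookup g (x ∷ xs) (t ∷ ts) (suc i) = ≤-trans (∑δ-lookup g xs ts i) (m≤n+m _ _)

  σ-mono : ∀ {d} (x y t : Vertex m d) → (∀ j → lookup x j ≡ lookup y j) → σ x t ≤ σ y t
  σ-mono []       []       []       eq = z≤n
  σ-mono (x ∷ xs) (y ∷ ys) (t ∷ ts) eq =
    +-mono-≤ (≤-reflexive (cong (λ z → δ z t) (eq zero))) (σ-mono xs ys ts (eq ∘ suc))

  σ-Adj : ∀ {d} (x y t : Vertex m d) → Adj m d x y → σ x t ≤ suc (σ y t)
  σ-Adj (x ∷ xs) (y ∷ ys) (t ∷ ts) (zero , adj , eq) =
    +-mono-≤ (δ-CAdj adj t) (σ-mono xs ys ts λ j → eq (suc j) λ ())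
  σ-Adj (x ∷ xs) (y ∷ ys) (t ∷ ts) (suc i , adj , eq) = ≤-trans
    (+-mono-≤ (≤-reflexive (cong (λ z → δ z t) (eq zero λ ())))
      (σ-Adj xs ys ts (i , adj , λ j j≢i → eq (suc j) λ { refl → j≢i refl })))
    (≤-reflexive (+-suc (δ y t) _))

  module _ {d : ℕ} where

    open Levels d

    -- One step changes one coordinate, and its distance by at most 1. Reaching distance 0 thus
    -- requires a coordinate at distance 1, and falling below level `s` requires `σ x t` to equal
    -- `s`; both put `x` on the boundary.
    cell-step : ∀ t s x y → Adj m d x y → Cell t s x → ¬ Boundary t s x → Cell t s y
    cell-step t s x y adj@(i , xy , eq) cell@(off , s≤σ) ¬bd = off′ , s≤σ′
      where
      off′ : Off y t
      off′ j with j Fin.≟ i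
      ... | no j≢i = subst (λ z → 1 ≤ δ z (lookup t j)) (eq j j≢i) (off j)
      ... | yes refl with 1 ≤? δ (lookup y j) (lookup t j)
      ...   | yes 1≤δ = 1≤δ
      ...   | no  1≰δ = contradiction (cell , inj₂ (≤-trans (≤-reflexive (sym (ind-yes (_ ≟ 1) δ≡1))) (∑δ-lookup _ x t j))) ¬bd
        where
        δ≡1 : δ (lookup x j) (lookup t j) ≡ 1
        δ≡1 = ≤-antisym (≤-trans (δ-CAdj xy (lookup t j)) (≰⇒> 1≰δ)) (off j)
      s≤σ′ : s ≤ σ y t
      s≤σ′ with s ≤? σ y t
      ... | yes p = p
      ... | no ¬p = contradiction (cell , inj₁ (≤-antisym s≤σ (≤-trans (σ-Adj x y t adj) (≰⇒> ¬p)))) ¬bd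

    -- A cycle that avoids the boundary and enters the cell stays in it. But a nontrivial cycle
    -- takes the value of the centre in some coordinate, where the distance is 0.
    cycle-leaves-cell : ∀ (C : Cycle m d) → Nontrivial m d C → ∀ t s →
      (∀ k → k ≤ len C → ¬ Boundary t s (vtx C k)) → ∀ k → k ≤ len C → ¬ Cell t s (vtx C k)
    cycle-leaves-cell C nt t s ¬bd k k≤ in-k = ⊥-elim (1≰δ (off c))
      where
      inside : ∀ k → k ≤ len C → Cell t s (vtx C 0) → Cell t s (vtx C k)
      inside zero    _  in-0 = in-0
      inside (suc k) k< in-0 = cell-step t s (vtx C k) (vtx C (suc k)) (adjacent C k) (inside k (<⇒≤ k<) in-0) (¬bd k (<⇒≤ k<))
      -- Going back to index 0 and then forward keeps every visited index within `len C`, where the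
      -- boundary is known to be avoided.
      start : ∀ k → k ≤ len C → Cell t s (vtx C k) → Cell t s (vtx C 0)
      start zero    _  in-k = in-k
      start (suc k) k< in-k = start k (<⇒≤ k<)
        (cell-step t s (vtx C (suc k)) (vtx C k) (Adj-sym (vtx C k) (vtx C (suc k)) (adjacent C k)) in-k (¬bd (suc k) k<))
      meet = nontrivial-meets C nt t
      c = proj₁ (proj₂ (proj₂ meet))
      off : Off (vtx C (proj₁ meet)) t
      off = proj₁ (inside (proj₁ meet) (proj₁ (proj₂ meet)) (start k k≤ in-k))
      1≰δ : ¬ 1 ≤ δ (lookup (vtx C (proj₁ meet)) c) (lookup t c)
      1≰δ 1≤δ = contradiction (subst (1 ≤_) (trans (cong (λ z → δ z (lookup t c)) (proj₂ (proj₂ (proj₂ meet)))) (δ-refl (lookup t c))) 1≤δ) λ ()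

-- Averaging over centres and levels

module Averages (m N b p D : ℕ) (1≤b : 1 ≤ b) (2≤N : 2 ≤ N) (m≡ : m ≡ suc N + (p + N))
  (1≤D : 1 ≤ D) (D-bound : suc D * b ^ N ≤ suc b ^ N) where

  open Cells m N b public
  open Levels D public

  W B : ∀ {d} → Vertex m d → ℕ
  W {d} x = ∑ (vertices m d) (F x)
  B {d} x = ∑ (vertices m d) (λ t → near x t * F x t)

  H : Fin m → ℕ
  H x = ∑ (allFin m) (λ t → h (δ x t))

  H-near : Fin m → ℕ
  H-near x = ∑ (allFin m) (λ t → ind (δ x t ≟ 1) * h (δ x t))

  -- Every distance 1, ..., N occurs at least twice, and the geometric sum of `h` over them is a(a^N
  -- - b^N), to which `D-bound` applies.
  H-lower : ∀ x → 2 * (a * (D * b ^ N)) ≤ H x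
  H-lower x = begin
    2 * (a * (D * b ^ N))                    ≤⟨ *-monoʳ-≤ 2 (*-monoʳ-≤ a geo) ⟩
    2 * (a * ∑< N (λ i → a ^ i * b ^ (N ∸ suc i)))
      ≡⟨ cong (2 *_) (trans (sym (∑<-*ˡ N a _)) (∑<-cong N λ i _ → sym (*-assoc a (a ^ i) _))) ⟩
    2 * ∑< N (λ j → h (suc j))               ≤⟨ m≤m+n _ _ ⟩
    2 * ∑< N (λ j → h (suc j)) + p * h N     ≡⟨ ∑<-φ p m≡ h ⟨
    ∑< m (h ∘ φ)                             ≡⟨ ∑-δ-rotate x h ⟨
    H x                                      ∎
    where
    open ≤-Reasoning
    geo : D * b ^ N ≤ ∑< N (λ i → a ^ i * b ^ (N ∸ suc i))
    geo = +-cancelˡ-≤ (b ^ N) _ _ (≤-trans D-bound (≤-reflexive (sym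
      (trans (geometric-∑ b N N ≤-refl) (trans (cong (λ z → a ^ N * b ^ z) (n∸n≡0 N)) (*-identityʳ _))))))

  -- Just two centres lie at distance 1, each of weight a b^(N-1), and a = b + 1 is at most 2b.
  H-near-upper : ∀ x → H-near x ≤ 4 * b ^ N
  H-near-upper x = begin
    H-near x                                        ≡⟨ ∑-δ-rotate x g ⟩
    ∑< m (g ∘ φ)                                    ≡⟨ ∑<-φ p m≡ g ⟩
    2 * ∑< N (λ j → g (suc j)) + p * g N
      ≡⟨ cong₂ _+_ (cong (2 *_) (trans (∑<-cong N λ j _ → *-comm (ind (j ≟ 0)) (h (suc j))) (∑<-ind-≟ (h ∘ suc) (<⇒≤ 2≤N)))) p*gN≡0 ⟩
    2 * h 1 + 0                                     ≡⟨ +-identityʳ _ ⟩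
    2 * (a ^ 1 * b ^ (N ∸ 1))
      ≤⟨ *-monoʳ-≤ 2 (*-monoˡ-≤ (b ^ (N ∸ 1)) (≤-trans (≤-reflexive (*-identityʳ a)) (+-monoˡ-≤ b 1≤b))) ⟩
    2 * ((b + b) * b ^ (N ∸ 1))
      ≡⟨ solve 2 (λ b c → con 2 :* ((b :+ b) :* c) := con 4 :* (b :* c)) refl b (b ^ (N ∸ 1)) ⟩
    4 * b ^ suc (N ∸ 1)                             ≡⟨ cong (λ z → 4 * b ^ z) (m+[n∸m]≡n (<⇒≤ 2≤N)) ⟩
    4 * b ^ N                                       ∎
    where
    open ≤-Reasoning
    open +-*-Solver
    g : ℕ → ℕ
    g j = ind (j ≟ 1) * h j
    -- The plateau lies at height N, and `2 ≤ N` keeps it away from distance 1.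
    p*gN≡0 : p * g N ≡ 0
    p*gN≡0 = trans (cong (λ z → p * (z * h N)) (ind-no (N ≟ 1) (≢-sym (<⇒≢ 2≤N)))) (*-zeroʳ p)

  W-∷ : ∀ {d} x (xs : Vertex m d) → W (x ∷ xs) ≡ H x * W xs
  W-∷ {d} x xs = trans (∑-vertices-suc m d _) (∑-vertices-* m d _ _)

  -- A product rule: `near` is additive and `F` multiplicative over the coordinates.
  B-∷ : ∀ {d} x (xs : Vertex m d) → B (x ∷ xs) ≡ H-near x * W xs + H x * B xs
  B-∷ {d} x xs = begin
    B (x ∷ xs)
      ≡⟨ ∑-vertices-suc m d _ ⟩
    ∑ (allFin m) (λ t → ∑ (vertices m d) (λ ts → (i t + near xs ts) * (h (δ x t) * F xs ts)))
      ≡⟨ ∑-cong (allFin m) (λ t → trans (∑-cong (vertices m d) λ ts → expand (i t) (near xs ts) (h (δ x t)) (F xs ts)) (∑-+ (vertices m d) _ _)) ⟩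
    ∑ (allFin m) (λ t → ∑ (vertices m d) (λ ts → i t * h (δ x t) * F xs ts) + ∑ (vertices m d) (λ ts → h (δ x t) * (near xs ts * F xs ts)))
      ≡⟨ ∑-+ (allFin m) _ _ ⟩
    ∑ (allFin m) (λ t → ∑ (vertices m d) (λ ts → i t * h (δ x t) * F xs ts))
      + ∑ (allFin m) (λ t → ∑ (vertices m d) (λ ts → h (δ x t) * (near xs ts * F xs ts)))
      ≡⟨ cong₂ _+_ (∑-vertices-* m d _ _) (∑-vertices-* m d _ _) ⟩
    H-near x * W xs + H x * B xs ∎
    where
    open ≡-Reasoning
    i : Fin m → ℕ
    i t = ind (δ x t ≟ 1)
    expand : ∀ i n h f → (i + n) * (h * f) ≡ i * h * f + h * (n * f)
    expand = solve 4 (λ i n h f → (i :+ n) :* (h :* f) := i :* h :* f :+ h :* (n :* f)) refl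
      where open +-*-Solver

  -- By the product rule each coordinate adds at most the fraction 2/(aD) of the total weight. The
  -- dimension `d` is kept apart from `D` so that the induction runs with `D` fixed; at d = D the
  -- fraction is 2/a.
  B≤W : ∀ {d} (x : Vertex m d) → a * D * B x ≤ 2 * (d * W x)
  B≤W {zero}  []       = ≤-reflexive (*-zeroʳ (a * D))
  B≤W {suc d} (x ∷ xs) = begin
    a * D * B (x ∷ xs)                        ≡⟨ cong (a * D *_) (B-∷ x xs) ⟩
    a * D * (H-near x * W xs + H x * B xs)    ≡⟨ expand (a * D) (H-near x) (W xs) (H x) (B xs) ⟩
    a * D * H-near x * W xs + H x * (a * D * B xs)  ≤⟨ +-mono-≤ (*-monoˡ-≤ (W xs) near≤H) (*-monoʳ-≤ (H x) (B≤W xs)) ⟩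
    2 * H x * W xs + H x * (2 * (d * W xs))   ≡⟨ collect (H x) (W xs) d ⟩
    2 * (suc d * (H x * W xs))                ≡⟨ cong (λ z → 2 * (suc d * z)) (W-∷ x xs) ⟨
    2 * (suc d * W (x ∷ xs))                  ∎
    where
    open ≤-Reasoning
    open +-*-Solver
    expand : ∀ k n w h b → k * (n * w + h * b) ≡ k * n * w + h * (k * b)
    expand = solve 5 (λ k n w h b → k :* (n :* w :+ h :* b) := k :* n :* w :+ h :* (k :* b)) refl
    collect : ∀ h w d → 2 * h * w + h * (2 * (d * w)) ≡ 2 * (suc d * (h * w))
    collect = solve 3 (λ h w d → con 2 :* h :* w :+ h :* (con 2 :* (d :* w)) := con 2 :* ((con 1 :+ d) :* (h :* w))) refl
    near≤H : a * D * H-near x ≤ 2 * H x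
    near≤H = begin
      a * D * H-near x            ≤⟨ *-monoʳ-≤ (a * D) (H-near-upper x) ⟩
      a * D * (4 * b ^ N)
        ≡⟨ solve 3 (λ a d c → a :* d :* (con 4 :* c) := con 2 :* (con 2 :* (a :* (d :* c)))) refl a D (b ^ N) ⟩
      2 * (2 * (a * (D * b ^ N))) ≤⟨ *-monoʳ-≤ 2 (H-lower x) ⟩
      2 * H x                     ∎

  W-positive : ∀ {d} (x : Vertex m d) → 0 < W x
  W-positive []       = z<s
  W-positive (x ∷ xs) = subst (0 <_) (sym (W-∷ x xs)) (*-mono-≤ {1} {_} {1} H>0 (W-positive xs))
    where
    H>0 : 0 < H x
    H>0 = ≤-trans (*-mono-≤ {1} {2} {1} (s≤s z≤n) (*-mono-≤ {1} {a} {1} (s≤s z≤n) (*-mono-≤ {1} {D} {1} 1≤D (m^n>0 b {{>-nonZero 1≤b}} N)))) (H-lower x)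

  ∑cell ∑boundary : Vertex m D → ℕ
  ∑cell     x = ∑ (vertices m D) (λ t → ∑ levels (λ s → w s * ind (cell? t s x)))
  ∑boundary x = ∑ (vertices m D) (λ t → ∑ levels (λ s → w s * ind (boundary? t s x)))

  ∑cell≡W : ∀ x → ∑cell x ≡ W x
  ∑cell≡W x = ∑-cong (vertices m D) λ t → cell-weight t x

  -- The level sets contribute 1/a and the coordinates at distance 1 contribute 2/a.
  ∑boundary-bound : ∀ x → a * ∑boundary x ≤ 3 * ∑cell x
  ∑boundary-bound x = begin
    a * ∑boundary x                                             ≡⟨ ∑-*ˡ a (vertices m D) _ ⟨
    ∑ (vertices m D) (λ t → a * ∑ levels (λ s → w s * ind (boundary? t s x)))
      ≤⟨ ∑-mono (vertices m D) (λ t → boundary-weight 1≤D t x) ⟩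
    ∑ (vertices m D) (λ t → F x t + a * (near x t * F x t))
      ≡⟨ trans (∑-+ (vertices m D) _ _) (cong (W x +_) (∑-*ˡ a (vertices m D) _)) ⟩
    W x + a * B x                                               ≤⟨ +-monoʳ-≤ (W x) a*B≤2*W ⟩
    3 * W x                                                     ≡⟨ cong (3 *_) (∑cell≡W x) ⟨
    3 * ∑cell x                                                 ∎
    where
    open ≤-Reasoning
    open +-*-Solver
    a*B≤2*W : a * B x ≤ 2 * W x
    a*B≤2*W = *-cancelˡ-≤ D {{>-nonZero 1≤D}} (≤-trans (≤-reflexive (solve 3 (λ d a b → d :* (a :* b) := a :* d :* b) refl D a (B x)))
      (≤-trans (B≤W x) (≤-reflexive (solve 2 (λ d w → con 2 :* (d :* w) := d :* (con 2 :* w)) refl D (W x)))))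

-- Greedy covering

module Greedy {m d : ℕ} {T : Set} {Cell Boundary : T → Vertex m d → Set}
  (cell? : ∀ t x → Dec (Cell t x)) (boundary? : ∀ t x → Dec (Boundary t x))
  (boundary⇒cell : ∀ {t x} → Boundary t x → Cell t x)
  (leaves-cell : ∀ C → Nontrivial m d C → ∀ t → (∀ k → k ≤ len C → ¬ Boundary t (vtx C k)) →
    ∀ k → k ≤ len C → ¬ Cell t (vtx C k))
  (q r : ℕ)
  (good-cell : ∀ u us → ∃[ t ] (q * length (filter (boundary? t) (u ∷ us)) ≤ r * length (filter (cell? t) (u ∷ us))
                                × 0 < length (filter (cell? t) (u ∷ us)))) where

  Separates : List (Vertex m d) → List (Vertex m d) → Set
  Separates U S = ∀ (C : Cycle m d) → Nontrivial m d C → (∀ k → k ≤ len C → vtx C k ∈ U) → ∃[ k ] (vtx C k ∈ S)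

  -- Strong induction with `n` as a bound on the length, which drops because the chosen cell meets
  -- `U`. A cycle in `U` that avoids the boundary of that cell misses the cell altogether, so it
  -- lies in the remainder and is met by the recursive set.
  separator : ∀ n U → length U ≤ n → Unique U →
    ∃[ S ] (Unique S × (∀ {x} → x ∈ S → x ∈ U) × q * length S ≤ r * length U × Separates U S)
  separator n [] _ _ = [] , [] , (λ ()) , ≤-trans (≤-reflexive (*-zeroʳ q)) z≤n , λ C _ C⊆U → contradiction (C⊆U 0 z≤n) λ ()
  separator (suc n) U@(u ∷ us) |U|≤n U! with good-cell u us
  ... | t , few , nonempty = ∂ ++ S , ∂++S! , ∂++S⊆U , count , separates
    where
    ∂ = filter (boundary? t) U
    A = filter (cell? t) U
    U′ = filter (λ x → ¬? (cell? t x)) U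
    split : length A + length U′ ≡ length U
    split = length-filter-¬ (cell? t) U
    rest = separator n U′ (≤-pred (≤-trans (+-monoˡ-≤ (length U′) nonempty) (≤-trans (≤-reflexive split) |U|≤n)))
      (filter⁺ (λ x → ¬? (cell? t x)) U!)
    S = proj₁ rest
    S⊆U′ : ∀ {x} → x ∈ S → x ∈ U′
    S⊆U′ = proj₁ (proj₂ (proj₂ rest))
    ∂++S! : Unique (∂ ++ S)
    ∂++S! = ++⁺ (filter⁺ (boundary? t) U!) (proj₁ (proj₂ rest)) λ (x∈∂ , x∈S) →
      proj₂ (∈-filter⁻ (λ x → ¬? (cell? t x)) {xs = U} (S⊆U′ x∈S))
        (boundary⇒cell (proj₂ (∈-filter⁻ (boundary? t) {xs = U} x∈∂)))
    ∂++S⊆U : ∀ {x} → x ∈ ∂ ++ S → x ∈ U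
    ∂++S⊆U x∈ with ∈-++⁻ ∂ x∈
    ... | inj₁ x∈∂ = proj₁ (∈-filter⁻ (boundary? t) {xs = U} x∈∂)
    ... | inj₂ x∈S = proj₁ (∈-filter⁻ (λ x → ¬? (cell? t x)) {xs = U} (S⊆U′ x∈S))
    count : q * length (∂ ++ S) ≤ r * length U
    count = begin
      q * length (∂ ++ S)                      ≡⟨ trans (cong (q *_) (length-++ ∂)) (*-distribˡ-+ q (length ∂) _) ⟩
      q * length ∂ + q * length S              ≤⟨ +-mono-≤ few (proj₁ (proj₂ (proj₂ (proj₂ rest)))) ⟩
      r * length A + r * length U′     ≡⟨ trans (sym (*-distribˡ-+ r (length A) _)) (cong (r *_) split) ⟩
      r * length U                         ∎
      where open ≤-Reasoning
    separates : Separates U (∂ ++ S)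
    separates C nt C⊆U with anyUpTo? (λ k → boundary? t (vtx C k)) (suc (len C))
    ... | yes (k , k≤ , bd) = k , ∈-++⁺ˡ (∈-filter⁺ (boundary? t) (C⊆U k (≤-pred k≤)) bd)
    ... | no ¬bd =
      let k , k∈S = proj₂ (proj₂ (proj₂ (proj₂ rest))) C nt λ k k≤ →
            ∈-filter⁺ (λ x → ¬? (cell? t x)) (C⊆U k k≤) (leaves-cell C nt t (λ j j≤ bd → ¬bd (j , s≤s j≤ , bd)) k k≤)
      in k , ∈-++⁺ʳ ∂ k∈S

  spine : ∃[ S ] (IsVertexSpine m d S × q * length S ≤ r * m ^ d)
  spine =
    let S , S! , _ , count , separates = separator _ (vertices m d) ≤-refl (vertices-unique m d)
    in S , (S! , λ C nt → separates C nt λ k _ → ∈-vertices (vtx C k))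
         , subst (λ z → q * length S ≤ r * z) (length-vertices m d) count

-- Turns the weighted inequality at a selected level into one between cardinalities. Positivity of
-- the right-hand side permits the cancellation and also makes the cell nonempty.
cancel-weight : ∀ w r {n l} → w * n ≤ w * (r * l) → 0 < w * (r * l) → n ≤ r * l × 0 < l
cancel-weight (suc w) r {l = suc l} le _   = *-cancelˡ-≤ (suc w) le , z<s
cancel-weight (suc w) r {l = zero}  _  pos =
  contradiction (subst (0 <_) (trans (cong (suc w *_) (*-zeroʳ r)) (*-zeroʳ (suc w))) pos) λ ()

module GreedyCells (m N b p D e : ℕ) (1≤b : 1 ≤ b) (2≤N : 2 ≤ N) (m≡ : m ≡ suc N + (p + N))
  (1≤D : 1 ≤ D) (D-bound : suc D * b ^ N ≤ suc b ^ N) (1≤e : 1 ≤ e) (m≤2ea : m ≤ 2 * e * suc b) where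

  open CellGeometry m N b using (cycle-leaves-cell)
  open Averages m N b p D 1≤b 2≤N m≡ 1≤D D-bound

  -- Double counting: the weighted cardinalities are regrouped by the vertices of `U`, so that
  -- estimates valid at each vertex apply to an arbitrary `U`.
  weighted-count : {Q : Vertex m D → ℕ → Vertex m D → Set} (Q? : ∀ t s x → Dec (Q t s x)) → ∀ k U →
    ∑ (vertices m D) (λ t → ∑ levels (λ s → w s * (k * length (filter (Q? t s) U)))) ≡
    k * ∑ U (λ x → ∑ (vertices m D) (λ t → ∑ levels (λ s → w s * ind (Q? t s x))))
  weighted-count Q? k U = begin
    ∑ V (λ t → ∑ levels (λ s → w s * (k * length (filter (Q? t s) U))))
      ≡⟨ ∑-cong V (λ t → trans (∑-cong levels (λ s → inner t s)) (trans (∑-*ˡ k levels (λ s → ∑ U (q t s))) (cong (k *_) (∑-swap levels U (q t))))) ⟩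
    ∑ V (λ t → k * ∑ U (λ x → ∑ levels (λ s → q t s x)))
      ≡⟨ ∑-*ˡ k V _ ⟩
    k * ∑ V (λ t → ∑ U (λ x → ∑ levels (λ s → q t s x)))
      ≡⟨ cong (k *_) (∑-swap V U (λ t x → ∑ levels (λ s → q t s x))) ⟩
    k * ∑ U (λ x → ∑ V (λ t → ∑ levels (λ s → q t s x))) ∎
    where
    open ≡-Reasoning
    V = vertices m D
    q : Vertex m D → ℕ → Vertex m D → ℕ
    q t s x = w s * ind (Q? t s x)
    swap* : ∀ w k l → w * (k * l) ≡ k * (w * l)
    swap* = solve 3 (λ w k l → w :* (k :* l) := k :* (w :* l)) refl where open +-*-Solver
    inner : ∀ t s → w s * (k * length (filter (Q? t s) U)) ≡ k * ∑ U (q t s)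
    inner t s = trans (cong (λ z → w s * (k * z)) (length-filter-∑ (Q? t s) U))
      (trans (swap* (w s) k _) (cong (k *_) (sym (∑-*ˡ (w s) U _))))

  -- The fraction 3/a is at most 6e/m because m ≤ 2ea.
  boundary≤cell : ∀ x → m * ∑boundary x ≤ 6 * e * ∑cell x
  boundary≤cell x = begin
    m * ∑boundary x               ≤⟨ *-monoˡ-≤ (∑boundary x) m≤2ea ⟩
    2 * e * a * ∑boundary x       ≡⟨ *-assoc (2 * e) a _ ⟩
    2 * e * (a * ∑boundary x)     ≤⟨ *-monoʳ-≤ (2 * e) (∑boundary-bound x) ⟩
    2 * e * (3 * ∑cell x)         ≡⟨ solve 2 (λ e c → con 2 :* e :* (con 3 :* c) := con 6 :* e :* c) refl e (∑cell x) ⟩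
    6 * e * ∑cell x               ∎
    where
    open ≤-Reasoning
    open +-*-Solver

  -- The estimate at each vertex is summed over `U`; a favourable centre is then selected, and after
  -- it a favourable level for that centre.
  good-cell : ∀ u us → let U = u ∷ us in
    ∃[ ts ] let t , s = ts in (m * length (filter (boundary? t s) U) ≤ 6 * e * length (filter (cell? t s) U)
                   × 0 < length (filter (cell? t s) U))
  good-cell u us =
    let t , le-t , pos-t = ∑-select (vertices m D) (λ t → ∑ levels (f t)) (λ t → ∑ levels (g t)) total positive
        s , le-s , pos-s = ∑-select levels (f t) (g t) le-t pos-t
    in (t , s) , cancel-weight (w s) (6 * e) le-s pos-s
    where
    U = u ∷ us
    f g : Vertex m D → ℕ → ℕ
    f t s = w s * (m * length (filter (boundary? t s) U))
    g t s = w s * (6 * e * length (filter (cell? t s) U))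
    total : ∑ (vertices m D) (λ t → ∑ levels (f t)) ≤ ∑ (vertices m D) (λ t → ∑ levels (g t))
    total = begin
      ∑ (vertices m D) (λ t → ∑ levels (f t))  ≡⟨ weighted-count boundary? m U ⟩
      m * ∑ U ∑boundary                        ≡⟨ ∑-*ˡ m U ∑boundary ⟨
      ∑ U (λ x → m * ∑boundary x)              ≤⟨ ∑-mono U boundary≤cell ⟩
      ∑ U (λ x → 6 * e * ∑cell x)              ≡⟨ ∑-*ˡ (6 * e) U ∑cell ⟩
      6 * e * ∑ U ∑cell                        ≡⟨ weighted-count cell? (6 * e) U ⟨
      ∑ (vertices m D) (λ t → ∑ levels (g t))  ∎
      where open ≤-Reasoning
    positive : 0 < ∑ (vertices m D) (λ t → ∑ levels (g t))
    positive = subst (0 <_) (sym (weighted-count cell? (6 * e) U))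
      (*-mono-≤ {1} {6 * e} {1} (≤-trans 1≤e (m≤m+n e _)) (≤-trans (subst (0 <_) (sym (∑cell≡W u)) (W-positive u)) (m≤m+n _ _)))

  cell-spine : ∃[ S ] (IsVertexSpine m D S × m * length S ≤ 6 * e * m ^ D)
  cell-spine = Greedy.spine (λ (t , s) → cell? t s) (λ (t , s) → boundary? t s) proj₁
    (λ C nt (t , s) → cycle-leaves-cell C nt t s) m (6 * e) good-cell

-- The three spines

all-spine : ∀ m d → ∃[ S ] (IsVertexSpine m d S × m * length S ≤ m * m ^ d)
all-spine m d = vertices m d , (vertices-unique m d , λ C _ → 0 , ∈-vertices (vtx C 0))
  , ≤-reflexive (cong (m *_) (length-vertices m d))

module Box (m : ℕ) where

  zeros : ∀ {d} → Vertex (suc m) d → ℕ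
  zeros []       = 0
  zeros (x ∷ xs) = ind (toℕ x ≟ 0) + zeros xs

  lookup-zeros : ∀ {d} (x : Vertex (suc m) d) i → lookup x i ≡ zero → 1 ≤ zeros x
  lookup-zeros (x ∷ xs) zero    refl = s≤s z≤n
  lookup-zeros (x ∷ xs) (suc i) eq   = ≤-trans (lookup-zeros xs i eq) (m≤n+m _ _)

  -- Each of the `d` coordinates vanishes on a 1/m share of the vertices, here with `suc m` in place
  -- of m.
  ∑-zeros : ∀ d → suc m * ∑ (vertices (suc m) d) zeros ≡ d * suc m ^ d
  ∑-zeros zero    = *-zeroʳ (suc m)
  ∑-zeros (suc d) = begin
    n * ∑ (vertices n (suc d)) zeros
      ≡⟨ cong (n *_) (trans (∑-vertices-suc n d zeros) (trans (∑-cong (allFin n) λ t → trans (∑-+ V _ zeros) (cong (_+ Z) (∑-*ˡ′ t)))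
           (∑-+ (allFin n) (λ t → ind (toℕ t ≟ 0) * n ^ d) (λ _ → Z)))) ⟩
    n * (∑ (allFin n) (λ t → ind (toℕ t ≟ 0) * n ^ d) + ∑ (allFin n) (λ _ → Z))
      ≡⟨ cong (n *_) (cong₂ _+_ (trans (∑-*ʳ (n ^ d) (allFin n) (λ t → ind (toℕ t ≟ 0))) (cong (_* n ^ d) one))
           (trans (∑-allFin n (λ _ → Z)) (∑<-const n Z))) ⟩
    n * (1 * n ^ d + n * Z)
      ≡⟨ cong (λ z → n * (1 * n ^ d + z)) (∑-zeros d) ⟩
    n * (1 * n ^ d + d * n ^ d)
      ≡⟨ solve 3 (λ n d c → n :* (con 1 :* c :+ d :* c) := (con 1 :+ d) :* (n :* c)) refl n d (n ^ d) ⟩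
    suc d * (n * n ^ d) ∎
    where
    open ≡-Reasoning
    open +-*-Solver
    n = suc m
    V = vertices n d
    Z = ∑ V zeros
    ∑-*ˡ′ : ∀ (t : Fin n) → ∑ V (λ _ → ind (toℕ t ≟ 0)) ≡ ind (toℕ t ≟ 0) * n ^ d
    ∑-*ˡ′ t = trans (∑-cong V λ _ → sym (*-identityʳ _)) (trans (∑-*ˡ (ind (toℕ t ≟ 0)) V (λ _ → 1))
      (cong (ind (toℕ t ≟ 0) *_) (trans (∑-one V) (length-vertices n d))))
    one : ∑ (allFin n) (λ t → ind (toℕ t ≟ 0)) ≡ 1
    one = trans (∑-allFin n (λ k → ind (k ≟ 0))) (trans (∑<-cong n λ k _ → sym (*-identityˡ (ind (k ≟ 0)))) (∑<-ind-≟ {n} {0} (λ _ → 1) z<s))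

  box-spine : ∀ d → ∃[ S ] (IsVertexSpine (suc m) d S × suc m * length S ≤ d * suc m ^ d)
  box-spine d = S , (filter⁺ hit? (vertices-unique (suc m) d) , meets) , (begin
    suc m * length S                          ≡⟨ cong (suc m *_) (length-filter-∑ hit? (vertices (suc m) d)) ⟩
    suc m * ∑ (vertices (suc m) d) (λ x → ind (hit? x))
      ≤⟨ *-monoʳ-≤ (suc m) (∑-mono (vertices (suc m) d) λ x → ind-≤ (hit? x) λ p → p) ⟩
    suc m * ∑ (vertices (suc m) d) zeros      ≡⟨ ∑-zeros d ⟩
    d * suc m ^ d                             ∎)
    where
    open ≤-Reasoning
    hit? : (x : Vertex (suc m) d) → Dec (1 ≤ zeros x)
    hit? x = 1 ≤? zeros x
    S = filter hit? (vertices (suc m) d)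
    meets : ∀ C → Nontrivial (suc m) d C → ∃[ k ] (vtx C k ∈ S)
    meets C nt =
      -- A nontrivial cycle takes every value in some coordinate, in particular the value 0.
      let k , _ , c , eq = nontrivial-meets C nt (replicate d zero)
      in k , ∈-filter⁺ hit? (∈-vertices (vtx C k)) (lookup-zeros (vtx C k) c (trans eq (lookup-replicate c zero)))

-- Choice of the parameters e, b and N

isqrt : ∀ d → ∃[ e ] (e * e ≤ d × d < suc e * suc e)
isqrt zero    = 0 , z≤n , z<s
isqrt (suc d) with isqrt d
... | e , e²≤d , d< with suc d <? suc e * suc e
...   | yes d+1< = e , ≤-trans e²≤d (n≤1+n d) , d+1<
...   | no  d+1≮ = suc e , ≮⇒≥ d+1≮ , ≤-<-trans d< (*-mono-< (n<1+n (suc e)) (n<1+n (suc e)))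

-- This is (e + 1)^2 ≤ 2^e for e = 6 + k. It fails at e = 5, which fixes the threshold 6.
square≤2^ : ∀ k → (7 + k) * (7 + k) ≤ 2 ^ (6 + k)
square≤2^ zero    = ≤ᵇ⇒≤ 49 64 _
square≤2^ (suc k) = begin
  (8 + k) * (8 + k)                              ≤⟨ m≤m+n _ _ ⟩
  (8 + k) * (8 + k) + (k * k + 12 * k + 34)
    ≡⟨ solve 1 (λ k → (con 8 :+ k) :* (con 8 :+ k) :+ (k :* k :+ con 12 :* k :+ con 34) := con 2 :* ((con 7 :+ k) :* (con 7 :+ k))) refl k ⟩
  2 * ((7 + k) * (7 + k))                        ≤⟨ *-monoʳ-≤ 2 (square≤2^ k) ⟩
  2 * 2 ^ (6 + k)                                ∎
  where
  open ≤-Reasoning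
  open +-*-Solver

-- Bernoulli's inequality 1 + n/b ≤ (1 + 1/b)^n with denominators cleared.
bernoulli : ∀ b n → (b + n) * b ^ n ≤ b * suc b ^ n
bernoulli b zero    = ≤-reflexive (cong (_* 1) (+-identityʳ b))
bernoulli b (suc n) = begin
  -- The product (b + 1)(b + n) exceeds b(b + n + 1) by exactly n.
  (b + suc n) * (b * b ^ n)                 ≤⟨ m≤m+n _ (n * b ^ n) ⟩
  (b + suc n) * (b * b ^ n) + n * b ^ n
    ≡⟨ solve 3 (λ b n c → (b :+ (con 1 :+ n)) :* (b :* c) :+ n :* c := (con 1 :+ b) :* ((b :+ n) :* c)) refl b n (b ^ n) ⟩
  suc b * ((b + n) * b ^ n)                 ≤⟨ *-monoʳ-≤ (suc b) (bernoulli b n) ⟩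
  suc b * (b * suc b ^ n)
    ≡⟨ solve 2 (λ b c → (con 1 :+ b) :* (b :* c) := b :* ((con 1 :+ b) :* c)) refl b (suc b ^ n) ⟩
  b * suc b ^ suc n                         ∎
  where
  open ≤-Reasoning
  open +-*-Solver

doubling : ∀ b → 1 ≤ b → 2 * b ^ b ≤ suc b ^ b
doubling b 1≤b = *-cancelˡ-≤ b {{>-nonZero 1≤b}} (≤-trans
  (≤-reflexive (solve 2 (λ b c → b :* (con 2 :* c) := (b :+ b) :* c) refl b (b ^ b))) (bernoulli b b))
  where open +-*-Solver

2^e*b^≤ : ∀ e b → 1 ≤ b → 2 ^ e * b ^ (e * b) ≤ suc b ^ (e * b)
2^e*b^≤ zero    b 1≤b = ≤-refl
2^e*b^≤ (suc e) b 1≤b = begin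
  2 * 2 ^ e * b ^ (b + e * b)              ≡⟨ cong (2 * 2 ^ e *_) (^-distribˡ-+-* b b (e * b)) ⟩
  2 * 2 ^ e * (b ^ b * b ^ (e * b))
    ≡⟨ solve 3 (λ p q r → con 2 :* p :* (q :* r) := con 2 :* q :* (p :* r)) refl (2 ^ e) (b ^ b) (b ^ (e * b)) ⟩
  2 * b ^ b * (2 ^ e * b ^ (e * b))        ≤⟨ *-mono-≤ (doubling b 1≤b) (2^e*b^≤ e b 1≤b) ⟩
  suc b ^ b * suc b ^ (e * b)              ≡⟨ ^-distribˡ-+-* (suc b) b (e * b) ⟨
  suc b ^ (b + e * b)                      ∎
  where
  open ≤-Reasoning
  open +-*-Solver

-- With b the quotient of m - 1 by 2e and N = eb, a cycle of length m splits into a centre, two arms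
-- of length N and the remainder of the division. Then d + 1 ≤ (e + 1)^2 ≤ 2^e ≤ (1 + 1/b)^N gives
-- the growth condition.
cells-spine : ∀ m d e → e * e ≤ d → d < suc e * suc e → 6 ≤ e → 36 * d < m * m →
  ∃[ S ] (IsVertexSpine m d S × m * length S ≤ 6 * e * m ^ d)
cells-spine zero    d e e²≤d d< 6≤e ()
cells-spine (suc n) d e@(suc _) e²≤d d< 6≤e 36d<m² =
  GreedyCells.cell-spine (suc n) (e * b) b r d e 1≤b 2≤N m≡ 1≤d d-bound (≤-trans (s≤s z≤n) 6≤e) m≤
  where
  open +-*-Solver
  b = n / (2 * e)
  r = n % (2 * e)
  n≡ : n ≡ r + b * (2 * e)
  n≡ = m≡m%n+[m/n]*n n (2 * e)
  m≡ : suc n ≡ suc (e * b) + (r + e * b)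
  m≡ = cong suc (trans n≡ (solve 3 (λ r b e → r :+ b :* (con 2 :* e) := e :* b :+ (r :+ e :* b)) refl r b e))
  r< : suc r ≤ 2 * e
  r< = m%n<n n (2 * e)
  m≤ : suc n ≤ 2 * e * suc b
  m≤ = ≤-trans (≤-reflexive (cong suc n≡)) (≤-trans (+-monoˡ-≤ (b * (2 * e)) r<)
    (≤-reflexive (solve 2 (λ e b → con 2 :* e :+ b :* (con 2 :* e) := con 2 :* e :* (con 1 :+ b)) refl e b)))
  -- If b were 0, then m ≤ 2e and m^2 ≤ 4d, against 36d < m^2.
  1≤b : 1 ≤ b
  1≤b with 1 ≤? b
  ... | yes p = p
  ... | no ¬p = contradiction 36d<m² (≤⇒≯ (begin
    suc n * suc n              ≤⟨ *-mono-≤ m≤2e m≤2e ⟩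
    2 * e * (2 * e)            ≡⟨ solve 1 (λ e → con 2 :* e :* (con 2 :* e) := con 4 :* (e :* e)) refl e ⟩
    4 * (e * e)                ≤⟨ *-mono-≤ (≤ᵇ⇒≤ 4 36 _) e²≤d ⟩
    36 * d                     ∎))
    where
    open ≤-Reasoning
    m≤2e : suc n ≤ 2 * e
    m≤2e = ≤-trans m≤ (≤-reflexive (trans (cong (λ z → 2 * e * suc z) (n≤0⇒n≡0 (≤-pred (≰⇒> ¬p)))) (*-identityʳ (2 * e))))
  2≤N : 2 ≤ e * b
  2≤N = *-mono-≤ {2} {e} {1} (≤-trans (≤ᵇ⇒≤ 2 6 _) 6≤e) 1≤b
  1≤d : 1 ≤ d
  1≤d = ≤-trans (s≤s z≤n) e²≤d
  1+d≤2^e : suc d ≤ 2 ^ e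
  1+d≤2^e = ≤-trans d< (subst (λ z → suc z * suc z ≤ 2 ^ z) (m+[n∸m]≡n 6≤e) (square≤2^ (e ∸ 6)))
  d-bound : suc d * b ^ (e * b) ≤ suc b ^ (e * b)
  d-bound = ≤-trans (*-monoˡ-≤ (b ^ (e * b)) 1+d≤2^e) (2^e*b^≤ e b 1≤b)

-- Lower bound for the Leibniz sums

fromℚᵘ-mono-≤ : ∀ {p q} → p ℚᵘ.≤ q → ℚ.fromℚᵘ p ℚ.≤ ℚ.fromℚᵘ q
fromℚᵘ-mono-≤ {p} {q} p≤q = ℚₚ.toℚᵘ-cancel-≤
  (ℚᵘₚ.≤-respˡ-≃ (ℚᵘₚ.≃-sym (ℚₚ.toℚᵘ-fromℚᵘ p)) (ℚᵘₚ.≤-respʳ-≃ (ℚᵘₚ.≃-sym (ℚₚ.toℚᵘ-fromℚᵘ q)) p≤q))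

ℕ→ℚ-mono : ∀ {m n} → m ≤ n → ℕ→ℚ m ℚ.≤ ℕ→ℚ n
ℕ→ℚ-mono {m} {n} m≤n = fromℚᵘ-mono-≤ {mkℚᵘ (ℤ.+ m) 0} {mkℚᵘ (ℤ.+ n) 0} (*≤* (ℤₚ.*-monoʳ-≤-nonNeg (ℤ.+ 1) (ℤ.+≤+ m≤n)))

ℕ→ℚ-* : ∀ m n → ℕ→ℚ (m * n) ≡ ℕ→ℚ m ℚ.* ℕ→ℚ n
ℕ→ℚ-* m n = ℚₚ.toℚᵘ-injective (begin
  ℚ.toℚᵘ (ℕ→ℚ (m * n))                      ≈⟨ ℚₚ.toℚᵘ-fromℚᵘ (mkℚᵘ (ℤ.+ (m * n)) 0) ⟩
  mkℚᵘ (ℤ.+ (m * n)) 0                      ≡⟨ cong (λ z → mkℚᵘ z 0) (ℤₚ.pos-* m n) ⟩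
  mkℚᵘ (ℤ.+ m) 0 ℚᵘ.* mkℚᵘ (ℤ.+ n) 0
    ≈⟨ ℚᵘₚ.*-cong (ℚₚ.toℚᵘ-fromℚᵘ (mkℚᵘ (ℤ.+ m) 0)) (ℚₚ.toℚᵘ-fromℚᵘ (mkℚᵘ (ℤ.+ n) 0)) ⟨
  ℚ.toℚᵘ (ℕ→ℚ m) ℚᵘ.* ℚ.toℚᵘ (ℕ→ℚ n)        ≈⟨ ℚₚ.toℚᵘ-homo-* (ℕ→ℚ m) (ℕ→ℚ n) ⟨
  ℚ.toℚᵘ (ℕ→ℚ m ℚ.* ℕ→ℚ n)                  ∎)
  where open ℚᵘₚ.≃-Reasoning

leibnizTerm-even : ∀ k → k % 2 ≡ 0 → leibnizTerm k ≡ ℤ.+ 4 ℚ./ suc (2 * k)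
leibnizTerm-even k eq with k % 2
leibnizTerm-even k refl | .0 = refl

leibnizTerm-odd : ∀ k → k % 2 ≡ 1 → leibnizTerm k ≡ ℚ.- (ℤ.+ 4 ℚ./ suc (2 * k))
leibnizTerm-odd k eq with k % 2
leibnizTerm-odd k refl | .1 = refl

4/-antitone : ∀ {m n} → m ≤ n → ℤ.+ 4 ℚ./ suc n ℚ.≤ ℤ.+ 4 ℚ./ suc m
4/-antitone {m} {n} m≤n = fromℚᵘ-mono-≤ {mkℚᵘ (ℤ.+ 4) n} {mkℚᵘ (ℤ.+ 4) m} (*≤* (ℤₚ.*-monoˡ-≤-nonNeg (ℤ.+ 4) (ℤ.+≤+ (s≤s m≤n))))

4/-nonneg : ∀ n → 0ℚ ℚ.≤ ℤ.+ 4 ℚ./ suc n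
4/-nonneg n = fromℚᵘ-mono-≤ {mkℚᵘ (ℤ.+ 0) 0} {mkℚᵘ (ℤ.+ 4) n} (*≤* (ℤ.+≤+ z≤n))

p≤p+q : ∀ p {q} → 0ℚ ℚ.≤ q → p ℚ.≤ p ℚ.+ q
p≤p+q p {q} 0≤q = subst (ℚ._≤ p ℚ.+ q) (ℚₚ.+-identityʳ p) (ℚₚ.+-monoʳ-≤ p 0≤q)

-- The two added terms are a positive one and a negative one of no larger absolute value.
leibniz-even-step : ∀ k → k % 2 ≡ 0 → suc k % 2 ≡ 1 → leibniz k ℚ.≤ leibniz (suc (suc k))
leibniz-even-step k even odd = subst (leibniz k ℚ.≤_)
  (sym (ℚₚ.+-assoc (leibniz k) (leibnizTerm k) (leibnizTerm (suc k))))
  (p≤p+q (leibniz k) 0≤)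
  where
  4/ : ℕ → ℚ
  4/ j = ℤ.+ 4 ℚ./ suc (2 * j)
  0≤ : 0ℚ ℚ.≤ leibnizTerm k ℚ.+ leibnizTerm (suc k)
  0≤ = subst₂ ℚ._≤_ (ℚₚ.+-inverseʳ (4/ (suc k))) (sym (cong₂ ℚ._+_ (leibnizTerm-even k even) (leibnizTerm-odd (suc k) odd)))
    (ℚₚ.+-monoˡ-≤ (ℚ.- 4/ (suc k)) (4/-antitone (*-monoʳ-≤ 2 (n≤1+n k))))

double%2 : ∀ n → 2 * n % 2 ≡ 0 × suc (2 * n) % 2 ≡ 1
double%2 zero    = refl , refl
double%2 (suc n) = subst (λ z → z % 2 ≡ 0 × suc z % 2 ≡ 1) (sym (*-suc 2 n)) (double%2 n)

-- Even partial sums increase. The one with eight terms, about 3.017, is the first of them to reach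
-- 3; six terms give about 2.976.
3≤leibniz-even : ∀ n → ℕ→ℚ 3 ℚ.≤ leibniz (2 * (4 + n))
3≤leibniz-even zero    = from-yes (ℕ→ℚ 3 ℚₚ.≤? leibniz 8)
3≤leibniz-even (suc n) = subst (λ z → ℕ→ℚ 3 ℚ.≤ leibniz z) (sym (*-suc 2 (4 + n)))
  (ℚₚ.≤-trans (3≤leibniz-even n) (let even , odd = double%2 (4 + n) in leibniz-even-step (2 * (4 + n)) even odd))

3≤leibniz-odd : ∀ n → ℕ→ℚ 3 ℚ.≤ leibniz (suc (2 * n))
3≤leibniz-odd 0 = from-yes (ℕ→ℚ 3 ℚₚ.≤? leibniz 1)
3≤leibniz-odd 1 = from-yes (ℕ→ℚ 3 ℚₚ.≤? leibniz 3)
3≤leibniz-odd 2 = from-yes (ℕ→ℚ 3 ℚₚ.≤? leibniz 5)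
3≤leibniz-odd 3 = from-yes (ℕ→ℚ 3 ℚₚ.≤? leibniz 7)
-- From nine terms on, an odd partial sum is an even one that is already at least 3 plus a positive
-- term.
3≤leibniz-odd (suc (suc (suc (suc n)))) = ℚₚ.≤-trans (3≤leibniz-even n)
  (p≤p+q (leibniz k) (subst (0ℚ ℚ.≤_) (sym (leibnizTerm-even k (proj₁ (double%2 (4 + n))))) (4/-nonneg (2 * k))))
  where k = 2 * (4 + n)

-- From counting to the bound with π

bounded-if : ∀ N m d → N * N ≤ 36 * d * m ^ (2 * (d ∸ 1)) → BoundedBy2π√dm^[d-1] N m d
bounded-if N m d N²≤ n = begin
  -- The constant 36 splits as 4 times 9, and 9 is at most the square of every odd Leibniz sum.
  ℕ→ℚ (N * N)              ≤⟨ ℕ→ℚ-mono (≤-trans N²≤ (≤-reflexive (regroup d (m ^ (2 * (d ∸ 1)))))) ⟩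
  ℕ→ℚ (K * 9)              ≡⟨ ℕ→ℚ-* K 9 ⟩
  ℕ→ℚ K ℚ.* ℕ→ℚ 9          ≤⟨ ℚₚ.*-monoˡ-≤-nonNeg (ℕ→ℚ K) {{ℚ.nonNegative (ℕ→ℚ-mono (z≤n {K}))}} 9≤L² ⟩
  ℕ→ℚ K ℚ.* (L ℚ.* L)      ∎
  where
  open ℚₚ.≤-Reasoning
  K = 4 * d * m ^ (2 * (d ∸ 1))
  L = leibniz (suc (2 * n))
  regroup : ∀ d c → 36 * d * c ≡ 4 * d * c * 9
  regroup = solve 2 (λ d c → con 36 :* d :* c := con 4 :* d :* c :* con 9) refl where open +-*-Solver
  3≤L : ℕ→ℚ 3 ℚ.≤ L
  3≤L = 3≤leibniz-odd n
  9≤L² : ℕ→ℚ 9 ℚ.≤ L ℚ.* L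
  9≤L² = ℚₚ.≤-trans (ℚₚ.*-monoˡ-≤-nonNeg (ℕ→ℚ 3) 3≤L)
    (ℚₚ.*-monoʳ-≤-nonNeg L {{ℚ.nonNegative (ℚₚ.≤-trans (ℕ→ℚ-mono (z≤n {3})) 3≤L)}} 3≤L)

-- The common last step for all three spines: cancelling `m` gives N ≤ r m^(d-1), which is then
-- squared.
bounded : ∀ N m d r → 1 ≤ m → 1 ≤ d → m * N ≤ r * m ^ d → r * r ≤ 36 * d → BoundedBy2π√dm^[d-1] N m d
bounded N m (suc d) r 1≤m _ mN≤ r²≤ = bounded-if N m (suc d) (begin
  N * N                          ≤⟨ *-mono-≤ N≤ N≤ ⟩
  r * M * (r * M)                ≡⟨ solve 2 (λ r c → r :* c :* (r :* c) := r :* r :* (c :* (c :* con 1))) refl r M ⟩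
  r * r * M ^ 2                  ≤⟨ *-monoˡ-≤ (M ^ 2) r²≤ ⟩
  36 * suc d * M ^ 2             ≡⟨ cong (36 * suc d *_) (trans (^-*-assoc m d 2) (cong (m ^_) (*-comm d 2))) ⟩
  36 * suc d * m ^ (2 * d)       ∎)
  where
  open ≤-Reasoning
  open +-*-Solver
  M = m ^ d
  N≤ : N ≤ r * M
  N≤ = *-cancelˡ-≤ m {{>-nonZero 1≤m}} (≤-trans mN≤ (≤-reflexive (solve 3 (λ r m c → r :* (m :* c) := m :* (r :* c)) refl r m M)))

theorem2 : (m d : ℕ) → 3 ≤ m → 1 ≤ d →
    ∃[ S ] (IsVertexSpine m d S × BoundedBy2π√dm^[d-1] (length S) m d)
theorem2 m@(suc m′) d 3≤m 1≤d with m * m ≤? 36 * d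
... | yes m²≤36d =
  let S , spine , count = all-spine m d
  in S , spine , bounded (length S) m d m (s≤s z≤n) 1≤d count m²≤36d
... | no m²≰36d with d ≤? 36
...   | yes d≤36 =
  let S , spine , count = Box.box-spine m′ d
  in S , spine , bounded (length S) m d d (s≤s z≤n) 1≤d count (*-monoˡ-≤ d d≤36)
...   | no d≰36 =
  let e , e²≤d , d< = isqrt d
      S , spine , count = cells-spine m d e e²≤d d< (6≤ e d<) (≰⇒> m²≰36d)
  in S , spine , bounded (length S) m d (6 * e) (s≤s z≤n) 1≤d count (≤-trans (≤-reflexive (square e)) (*-monoʳ-≤ 36 e²≤d))
  where
  square : ∀ e → 6 * e * (6 * e) ≡ 36 * (e * e)
  square = solve 1 (λ e → con 6 :* e :* (con 6 :* e) := con 36 :* (e :* e)) refl where open +-*-Solver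
  -- For e ≤ 5 the bound d < (e + 1)^2 would give d < 36, whereas d > 36 in this case.
  6≤ : ∀ e → d < suc e * suc e → 6 ≤ e
  6≤ e d< with 6 ≤? e
  ... | yes p = p
  ... | no ¬p = contradiction (<-trans (≰⇒> d≰36) d<) (≤⇒≯ (*-mono-≤ (≰⇒> ¬p) (≰⇒> ¬p)))
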